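{- As $n\to\infty$, $f(n,3,3)\ge\Omega\left(\left(\frac{\ln n}{\ln\ln n}\right)^{1/2}\right)$; that is, there are constants $c>0$ and $n_0$ such that $f(n,3,3)\ge c\left(\frac{\ln n}{\ln\ln n}\right)^{1/2}$ for all $n\ge n_0$.
   Context: A $3$-digraph $G$ consists of a finite vertex set $V(G)$ and an edge set $E(G)$ whose elements are ordered triples of distinct vertices. A $(3,k)$-tournament is a $3$-digraph $G$ such that for every $3$-element set $S\subseteq V(G)$, exactly $k$ of the $6$ orderings of $S$ are edges of $G$. The tight path $P^{(3)}_s$ is the $3$-digraph with $s$ distinct vertices $v_1,\ldots,v_s$ whose edges are exactly the triples $(v_i,v_{i+1},v_{i+2})$, $1\le i\le s-2$ (no edges if $s<3$). A $3$-digraph $G$ contains $P^{(3)}_s$ if there is an injection of its vertices into $V(G)$ mapping edges to edges. $f(n,3,k)$ is the maximum integer $s$ such that every $n$-vertex $(3,k)$-tournament contains a copy of $P^{(3)}_s$. $\ln$ is the natural logarithm. -}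

module Defs where

open import Data.Bool.Base using (Bool; true; false; T; _∧_)
open import Data.Bool.Properties using (T?; T-∧)
open import Data.Fin.Base as Fin using (Fin; zero; suc; toℕ)
import Data.Fin.Properties as Fin
open import Data.Integer.Base as ℤ using (ℤ; +_; -[1+_])
import Data.Integer.Properties as ℤ
open import Data.List.Base using (List; []; _∷_; length; filterᵇ)
open import Data.List.Properties using (filter-≐)
open import Data.Nat.Base as ℕ using (ℕ; zero; suc)
import Data.Nat.Properties as ℕ
open import Data.Product.Base using (Σ; ∃; ∃-syntax; _×_; _,_; proj₁; proj₂)
open import Data.Rational.Base as ℚ
  using (ℚ; 0ℚ; 1ℚ; mkℚ; _/_; _+_; _*_; _-_; -_; _≤_; _<_; ∣_∣; 1/_; toℚᵘ; ↥_)
open import Data.Rational.Literals using (fromℤ)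
import Data.Rational.Properties as ℚ
open import Data.Rational.Solver using (module +-*-Solver)
open import Data.Rational.Unnormalised.Base as ℚᵘ using (mkℚᵘ)
import Data.Rational.Unnormalised.Properties as ℚᵘ
open import Data.Sum.Base using (_⊎_; inj₁; inj₂)
import Data.Vec.Functional as Vector
open import Function.Base using (_∘_)
open import Function.Bundles using (Equivalence)
open import Function.Definitions using (Injective)
open import Level using (0ℓ)
open import Relation.Binary.Core using (Rel)
open import Relation.Binary.PropositionalEquality
  using (_≡_; _≢_; _≗_; refl; sym; trans; cong; cong₂; subst; subst₂; module ≡-Reasoning)
open import Relation.Nullary using (¬_; Dec; yes; no; contradiction)
open import Relation.Nullary.Decidable
  using (⌊_⌋; map′; _×-dec_; _→-dec_; ¬?; toWitness; from-yes; decidable-stable)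
open import Relation.Unary using (Decidable)

open import Algebra.Definitions.RawSemiring ℚ.+-*-rawSemiring using (_^_)
open +-*-Solver using (solve; _:+_; _:*_; _:-_; :-_; _:=_; con)

-- Vertex sets are Fin n; every n-vertex 3-digraph is isomorphic to one of these.
record 3-Digraph (n : ℕ) : Set where
  field
    edge     : Fin n → Fin n → Fin n → Bool
    distinct : ∀ {a b c} → T (edge a b c) → a ≢ b × b ≢ c × a ≢ c

open 3-Digraph public

orderings : ∀ {A : Set} → A → A → A → List (A × A × A)
orderings a b c =
  (a , b , c) ∷ (a , c , b) ∷ (b , a , c) ∷ (b , c , a) ∷ (c , a , b) ∷ (c , b , a) ∷ []

IsTournament : ∀ {n} → ℕ → 3-Digraph n → Set
IsTournament {n} k G =
  ∀ (a b c : Fin n) → a ≢ b → b ≢ c → a ≢ c →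
  length (filterᵇ (λ (x , y , z) → edge G x y z) (orderings a b c)) ≡ k

tightPath : ∀ s → 3-Digraph s
tightPath s = record
  { edge     = λ i j k → ⌊ toℕ j ℕ.≟ suc (toℕ i) ⌋ ∧ ⌊ toℕ k ℕ.≟ suc (toℕ j) ⌋
  ; distinct = λ {i} {j} {k} e → consecutive⇒distinct i j k (Equivalence.to T-∧ e)
  }
  where
  consecutive⇒distinct : ∀ (i j k : Fin s) →
    T ⌊ toℕ j ℕ.≟ suc (toℕ i) ⌋ × T ⌊ toℕ k ℕ.≟ suc (toℕ j) ⌋ → i ≢ j × j ≢ k × i ≢ k
  consecutive⇒distinct i j k (p , q) with toWitness p | toWitness q
  ... | j≡1+i | k≡1+j =
      (λ { refl → ℕ.1+n≢n (sym j≡1+i) })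
    , (λ { refl → ℕ.1+n≢n (sym k≡1+j) })
    , (λ { refl → ℕ.m≢1+n+m (toℕ i) {1} (trans k≡1+j (cong suc j≡1+i)) })

Contains : ∀ {n s} → 3-Digraph n → 3-Digraph s → Set
Contains {n} {s} G H =
  Σ (Fin s → Fin n) λ φ → Injective _≡_ _≡_ φ ×
    (∀ a b c → T (edge H a b c) → T (edge G (φ a) (φ b) (φ c)))

ForcesTightPath : ℕ → ℕ → ℕ → Set
ForcesTightPath n k s = ∀ (G : 3-Digraph n) → IsTournament k G → Contains G (tightPath s)

IsMaximum : (ℕ → Set) → ℕ → Set
IsMaximum P m = P m × (∀ j → P j → j ℕ.≤ m)

-- Functions between finite sets can be searched exhaustively; without function
-- extensionality this needs the predicate to respect pointwise equality.

Searchable : (A : Set) → Rel A 0ℓ → Set₁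
Searchable A _≈_ = ∀ {P : A → Set} → (∀ {x y} → x ≈ y → P x → P y) → Decidable P → Dec (∃ P)

Pointwise : ∀ {A : Set} {m} → Rel A 0ℓ → Rel (Fin m → A) 0ℓ
Pointwise _≈_ f g = ∀ i → f i ≈ g i

search-Fin : ∀ {n} → Searchable (Fin n) _≡_
search-Fin _ P? = Fin.any? P?

search-Bool : Searchable Bool _≡_
search-Bool _ P? with P? true | P? false
... | yes p | _     = yes (true , p)
... | no _  | yes p = yes (false , p)
... | no ¬t | no ¬f = no λ { (true , p) → ¬t p ; (false , p) → ¬f p }

search-→ : ∀ {A : Set} {_≈_ : Rel A 0ℓ} → (∀ {x} → x ≈ x) → Searchable A _≈_ →
           ∀ m → Searchable (Fin m → A) (Pointwise _≈_)
search-→ ≈-refl search zero resp P? =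
  map′ (λ p → Vector.[] , p) (λ (f , p) → resp (λ ()) p) (P? Vector.[])
search-→ {A} {_≈_} ≈-refl search (suc m) {P} resp P? =
  map′ (λ (a , g , p) → a Vector.∷ g , p)
       (λ (f , p) → f zero , f ∘ suc , resp (λ { zero → ≈-refl ; (suc i) → ≈-refl }) p)
       (search resp-head λ a → search-→ ≈-refl search m (resp-tail a) (λ g → P? (a Vector.∷ g)))
  where
  resp-tail : ∀ a {g h} → Pointwise _≈_ g h → P (a Vector.∷ g) → P (a Vector.∷ h)
  resp-tail a g≈h = resp λ { zero → ≈-refl ; (suc i) → g≈h i }
  resp-head : ∀ {a b} → a ≈ b → (∃ λ g → P (a Vector.∷ g)) → ∃ λ g → P (b Vector.∷ g)
  resp-head a≈b (g , p) = g , resp (λ { zero → a≈b ; (suc i) → ≈-refl }) p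

injective? : ∀ {m n} → Decidable (Injective {A = Fin m} {B = Fin n} _≡_ _≡_)
injective? φ =
  map′ (λ inj {x} {y} → inj x y) (λ inj x y → inj {x} {y})
       (Fin.all? λ x → Fin.all? λ y → (φ x Fin.≟ φ y) →-dec (x Fin.≟ y))

contains? : ∀ {n s} (G : 3-Digraph n) (H : 3-Digraph s) → Dec (Contains G H)
contains? {n} {s} G H = search-→ refl search-Fin s resp λ φ → injective? φ ×-dec
  Fin.all? λ a → Fin.all? λ b → Fin.all? λ c →
    T? (edge H a b c) →-dec T? (edge G (φ a) (φ b) (φ c))
  where
  resp : ∀ {φ ψ : Fin s → Fin n} → φ ≗ ψ →
    Injective _≡_ _≡_ φ × (∀ a b c → T (edge H a b c) → T (edge G (φ a) (φ b) (φ c))) →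
    Injective _≡_ _≡_ ψ × (∀ a b c → T (edge H a b c) → T (edge G (ψ a) (ψ b) (ψ c)))
  resp φ≗ψ (inj , hom) =
      (λ {x} {y} eq → inj (trans (φ≗ψ x) (trans eq (sym (φ≗ψ y)))))
    , (λ a b c e → subst T
        (trans (cong₂ (λ x y → edge G x y _) (φ≗ψ a) (φ≗ψ b)) (cong (edge G _ _) (φ≗ψ c)))
        (hom a b c e))

isTournament? : ∀ {n} k (G : 3-Digraph n) → Dec (IsTournament k G)
isTournament? k G = Fin.all? λ a → Fin.all? λ b → Fin.all? λ c →
  ¬? (a Fin.≟ b) →-dec (¬? (b Fin.≟ c) →-dec (¬? (a Fin.≟ c) →-dec (_ ℕ.≟ k)))

private
  digraph : ∀ {n} (e : Fin n → Fin n → Fin n → Bool) →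
            (∀ a b c → T (e a b c) → a ≢ b × b ≢ c × a ≢ c) → 3-Digraph n
  digraph e d = record { edge = e ; distinct = λ {a} {b} {c} → d a b c }

  Avoids : ∀ n → ℕ → ℕ → (Fin n → Fin n → Fin n → Bool) → Set
  Avoids n k s e =
    Σ (∀ a b c → T (e a b c) → a ≢ b × b ≢ c × a ≢ c) λ d →
    IsTournament k (digraph e d) × ¬ Contains (digraph e d) (tightPath s)

  avoids-resp : ∀ {n k s} {e e′ : Fin n → Fin n → Fin n → Bool} →
    (∀ a b c → e a b c ≡ e′ a b c) → Avoids n k s e → Avoids n k s e′
  avoids-resp {n} {k} {s} {e} {e′} e≗e′ (d , tour , avoid) =
      (λ a b c t → d a b c (subst T (sym (e≗e′ a b c)) t))
    , (λ a b c a≢b b≢c a≢c → trans (sym (count a b c)) (tour a b c a≢b b≢c a≢c))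
    , (λ (φ , inj , hom) → avoid (φ , inj , λ a b c t →
        subst T (sym (e≗e′ (φ a) (φ b) (φ c))) (hom a b c t)))
    where
    count : ∀ a b c → length (filterᵇ (λ (x , y , z) → e x y z) (orderings a b c))
                    ≡ length (filterᵇ (λ (x , y , z) → e′ x y z) (orderings a b c))
    count a b c = cong length (filter-≐ (λ (x , y , z) → T? (e x y z)) (λ (x , y , z) → T? (e′ x y z))
      ( (λ {(x , y , z)} → subst T (e≗e′ x y z))
      , (λ {(x , y , z)} → subst T (sym (e≗e′ x y z)))) (orderings a b c))

  avoids? : ∀ n k s → Decidable (Avoids n k s)
  avoids? n k s e with (Fin.all? λ a → Fin.all? λ b → Fin.all? λ c → T? (e a b c) →-dec
                        (¬? (a Fin.≟ b) ×-dec (¬? (b Fin.≟ c) ×-dec ¬? (a Fin.≟ c))))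
  ... | no ¬d = no (¬d ∘ proj₁)
  ... | yes d with isTournament? k (digraph e d) ×-dec ¬? (contains? (digraph e d) (tightPath s))
  ... | yes (tour , avoid) = yes (d , tour , avoid)
  ... | no ¬p = no λ (_ , tour , avoid) → ¬p (tour , avoid)

forcesTightPath? : ∀ n k → Decidable (ForcesTightPath n k)
forcesTightPath? n k s with
  search-→ (λ _ _ → refl) (search-→ (λ _ → refl) (search-→ refl search-Bool n) n) n
    (avoids-resp {n} {k} {s}) (avoids? n k s)
... | yes (e , d , tour , avoid) = no λ forces → avoid (forces (digraph e d) tour)
... | no none = yes λ G tour → decidable-stable (contains? G (tightPath s)) λ avoid →
  none (edge G , (λ a b c → distinct G) , tour , avoid)

-- The largest i ≤ m with P i, or 0 if there is none.
greatest : {P : ℕ → Set} → Decidable P → ℕ → ℕ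
greatest P? zero    = zero
greatest P? (suc m) with P? (suc m)
... | yes _ = suc m
... | no _  = greatest P? m

greatest-holds : ∀ {P : ℕ → Set} (P? : Decidable P) m → P 0 → P (greatest P? m)
greatest-holds P? zero    p₀ = p₀
greatest-holds P? (suc m) p₀ with P? (suc m)
... | yes p = p
... | no _  = greatest-holds P? m p₀

greatest-upper : ∀ {P : ℕ → Set} (P? : Decidable P) m i → i ℕ.≤ m → P i → i ℕ.≤ greatest P? m
greatest-upper P? zero    i i≤0 _ = i≤0
greatest-upper P? (suc m) i i≤1+m p with P? (suc m)
... | yes _ = i≤1+m
... | no ¬p with ℕ.m≤n⇒m<n∨m≡n i≤1+m
...   | inj₁ i<1+m = greatest-upper P? m i (ℕ.s≤s⁻¹ i<1+m) p
...   | inj₂ refl  = contradiction p ¬p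

greatest-holds-or-zero : ∀ {P : ℕ → Set} (P? : Decidable P) m →
                         greatest P? m ≡ 0 ⊎ P (greatest P? m)
greatest-holds-or-zero P? zero    = inj₁ refl
greatest-holds-or-zero P? (suc m) with P? (suc m)
... | yes p = inj₂ p
... | no _  = greatest-holds-or-zero P? m

-- A tight path with more than n vertices embeds in no n-vertex 3-digraph, so the
-- search may stop at n.
f₃ : ℕ → ℕ → ℕ
f₃ n k = greatest (forcesTightPath? n k) n

f₃-isMaximum : ∀ {n k} (G : 3-Digraph n) → IsTournament k G →
               IsMaximum (ForcesTightPath n k) (f₃ n k)
f₃-isMaximum {n} {k} G tour =
    greatest-holds (forcesTightPath? n k) n
      (λ _ _ → (λ ()) , (λ { {()} }) , λ ())
  , λ s forces → greatest-upper (forcesTightPath? n k) n s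
      (Fin.injective⇒≤ (proj₁ (proj₂ (forces G tour)))) forces

ι : ℕ → ℚ
ι n = fromℤ (+ n)

-- Reciprocal, with value 0 at 0.
inv : ℚ → ℚ
inv q with q ℚ.≟ 0ℚ
... | yes _  = 0ℚ
... | no q≢0 = (1/ q) {{ℚ.≢-nonZero q≢0}}

toℚᵘ-ι : ∀ n → toℚᵘ (ι n) ℚᵘ.≃ mkℚᵘ (+ n) 0
toℚᵘ-ι n = ℚᵘ.≃-refl

ι-suc : ∀ n → ι (suc n) ≡ ι n + 1ℚ
ι-suc n = ℚ.toℚᵘ-injective (ℚᵘ.≃-trans (toℚᵘ-ι (suc n)) (ℚᵘ.≃-sym
  (ℚᵘ.≃-trans (ℚ.toℚᵘ-homo-+ (ι n) 1ℚ)
  (ℚᵘ.≃-trans (ℚᵘ.+-cong (toℚᵘ-ι n) (toℚᵘ-ι 1))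
              (ℚᵘ.*≡* (cong (ℤ._* (+ 1)) eq))))))
  where
  eq : + n ℤ.* + 1 ℤ.+ + 1 ℤ.* + 1 ≡ + suc n
  eq = trans (cong (ℤ._+ (+ 1)) (ℤ.*-identityʳ (+ n))) (cong +_ (ℕ.+-comm n 1))

ι-* : ∀ m n → ι (m ℕ.* n) ≡ ι m * ι n
ι-* m n = ℚ.toℚᵘ-injective (ℚᵘ.≃-trans (toℚᵘ-ι (m ℕ.* n)) (ℚᵘ.≃-sym
  (ℚᵘ.≃-trans (ℚ.toℚᵘ-homo-* (ι m) (ι n))
  (ℚᵘ.≃-trans (ℚᵘ.*-cong (toℚᵘ-ι m) (toℚᵘ-ι n))
              (ℚᵘ.*≡* (cong (ℤ._* (+ 1)) (sym (ℤ.pos-* m n))))))))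

ι-mono : ∀ {m n} → m ℕ.≤ n → ι m ≤ ι n
ι-mono {m} {n} m≤n = ℚ.toℚᵘ-cancel-≤
  (ℚᵘ.≤-trans (ℚᵘ.≤-reflexive (toℚᵘ-ι m)) (ℚᵘ.≤-trans
    (ℚᵘ.*≤* (ℤ.*-monoʳ-≤-nonNeg (+ 1) (ℤ.+≤+ m≤n)))
    (ℚᵘ.≤-reflexive (ℚᵘ.≃-sym (toℚᵘ-ι n)))))

q≤ι : ∀ q → q ≤ ι ℤ.∣ ↥ q ∣
q≤ι q@(mkℚ i d _) = ℚ.toℚᵘ-cancel-≤
  (ℚᵘ.≤-trans (ℚᵘ.*≤* (lemma i)) (ℚᵘ.≤-reflexive (ℚᵘ.≃-sym (toℚᵘ-ι ℤ.∣ i ∣))))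
  where
  lemma : ∀ j → j ℤ.* + 1 ℤ.≤ + ℤ.∣ j ∣ ℤ.* + suc d
  lemma (+ k) = subst₂ ℤ._≤_ (sym (ℤ.*-identityʳ (+ k))) (ℤ.pos-* k (suc d))
    (ℤ.+≤+ (ℕ.m≤m*n k (suc d)))
  lemma -[1+ k ] = ℤ.-≤+

0<1 : 0ℚ < 1ℚ
0<1 = from-yes (0ℚ ℚ.<? 1ℚ)

p<p+1 : ∀ p → p < p + 1ℚ
p<p+1 p = subst (_< p + 1ℚ) (ℚ.+-identityʳ p) (ℚ.+-monoʳ-< p 0<1)

0≤ι : ∀ n → 0ℚ ≤ ι n
0≤ι n = ι-mono {0} {n} ℕ.z≤n

0<ι : ∀ n → 0ℚ < ι (suc n)
0<ι n = ℚ.<-≤-trans 0<1 (ι-mono {1} {suc n} (ℕ.s≤s ℕ.z≤n))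

*-nonNeg : ∀ {p q} → 0ℚ ≤ p → 0ℚ ≤ q → 0ℚ ≤ p * q
*-nonNeg {p} {q} 0≤p 0≤q = ℚ.nonNegative⁻¹ (p * q)
  {{ℚ.nonNeg*nonNeg⇒nonNeg p {{ℚ.nonNegative 0≤p}} q {{ℚ.nonNegative 0≤q}}}}

*-pos : ∀ {p q} → 0ℚ < p → 0ℚ < q → 0ℚ < p * q
*-pos {p} {q} 0<p 0<q = ℚ.positive⁻¹ (p * q)
  {{ℚ.pos*pos⇒pos p {{ℚ.positive 0<p}} q {{ℚ.positive 0<q}}}}

*-monoʳ : ∀ {p q r} → 0ℚ ≤ r → p ≤ q → p * r ≤ q * r
*-monoʳ {r = r} 0≤r = ℚ.*-monoʳ-≤-nonNeg r {{ℚ.nonNegative 0≤r}}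

*-mono : ∀ {p q r s} → 0ℚ ≤ p → p ≤ q → 0ℚ ≤ r → r ≤ s → p * r ≤ q * s
*-mono {p} {q} {r} {s} 0≤p p≤q 0≤r r≤s = ℚ.≤-trans (*-monoʳ 0≤r p≤q)
  (ℚ.*-monoˡ-≤-nonNeg q {{ℚ.nonNegative (ℚ.≤-trans 0≤p p≤q)}} r≤s)

+-nonNeg : ∀ {p q} → 0ℚ ≤ p → 0ℚ ≤ q → 0ℚ ≤ p + q
+-nonNeg = ℚ.+-mono-≤

≤-from-diff : ∀ {p q} r → 0ℚ ≤ r → p + r ≡ q → p ≤ q
≤-from-diff {p} r 0≤r refl = subst (_≤ p + r) (ℚ.+-identityʳ p) (ℚ.+-monoʳ-≤ p 0≤r)

0≤diff : ∀ {p q} → p ≤ q → 0ℚ ≤ q - p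
0≤diff {p} {q} p≤q = subst (_≤ q - p) (ℚ.+-inverseʳ p) (ℚ.+-monoˡ-≤ (- p) p≤q)

<-from-diff : ∀ {p q} r → 0ℚ < r → p + r ≡ q → p < q
<-from-diff {p} r 0<r refl = subst (_< p + r) (ℚ.+-identityʳ p) (ℚ.+-monoʳ-< p 0<r)

*-inv : ∀ {q} → 0ℚ < q → q * inv q ≡ 1ℚ
*-inv {q} 0<q with q ℚ.≟ 0ℚ
... | yes refl = contradiction 0<q (ℚ.<-irrefl refl)
... | no q≢0   = ℚ.*-inverseʳ q {{ℚ.≢-nonZero q≢0}}

0<inv : ∀ {q} → 0ℚ < q → 0ℚ < inv q
0<inv {q} 0<q with 0ℚ ℚ.<? inv q
... | yes 0<i = 0<i
... | no 0≮i  = contradiction (ℚ.≤-trans (ℚ.≤-reflexive (sym (*-inv 0<q))) q*i≤0)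
                              (λ 1≤0 → ℚ.<-irrefl refl (ℚ.<-≤-trans 0<1 1≤0))
  where
  q*i≤0 : q * inv q ≤ 0ℚ
  q*i≤0 = subst (q * inv q ≤_) (ℚ.*-zeroʳ q)
    (ℚ.*-monoˡ-≤-nonNeg q {{ℚ.nonNegative (ℚ.<⇒≤ 0<q)}} (ℚ.≮⇒≥ 0≮i))

0≤inv : ∀ {q} → 0ℚ < q → 0ℚ ≤ inv q
0≤inv = ℚ.<⇒≤ ∘ 0<inv

inv-diff : ∀ {p q} → 0ℚ < p → 0ℚ < q → inv p - inv q ≡ (q - p) * (inv p * inv q)
inv-diff {p} {q} 0<p 0<q = sym (begin
  (q - p) * (inv p * inv q)
    ≡⟨ solve 4 (λ p q i j → (q :- p) :* (i :* j) := q :* j :* i :- p :* i :* j) refl p q (inv p) (inv q) ⟩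
  q * inv q * inv p - p * inv p * inv q
    ≡⟨ cong₂ (λ u v → u * inv p - v * inv q) (*-inv 0<q) (*-inv 0<p) ⟩
  1ℚ * inv p - 1ℚ * inv q
    ≡⟨ cong₂ _-_ (ℚ.*-identityˡ (inv p)) (ℚ.*-identityˡ (inv q)) ⟩
  inv p - inv q ∎)
  where open ≡-Reasoning

inv-anti : ∀ {p q} → 0ℚ < p → p ≤ q → inv q ≤ inv p
inv-anti {p} {q} 0<p p≤q = ≤-from-diff (inv p - inv q)
  (subst (0ℚ ≤_) (sym (inv-diff 0<p 0<q))
    (*-nonNeg (0≤diff p≤q) (*-nonNeg (0≤inv 0<p) (0≤inv 0<q))))
  (solve 2 (λ i j → j :+ (i :- j) := i) refl (inv p) (inv q))
  where
  0<q : 0ℚ < q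
  0<q = ℚ.<-≤-trans 0<p p≤q

∣∣-bound : ∀ {p q} → p ≤ q → - p ≤ q → ∣ p ∣ ≤ q
∣∣-bound {p} p≤q -p≤q with ℚ.∣p∣≡p∨∣p∣≡-p p
... | inj₁ eq = subst (_≤ _) (sym eq) p≤q
... | inj₂ eq = subst (_≤ _) (sym eq) -p≤q

p≤∣p∣ : ∀ p → p ≤ ∣ p ∣
p≤∣p∣ p with ℚ.≤-total 0ℚ p
... | inj₁ 0≤p = ℚ.≤-reflexive (sym (ℚ.0≤p⇒∣p∣≡p 0≤p))
... | inj₂ p≤0 = ℚ.≤-trans p≤0 (ℚ.0≤∣p∣ p)

-p≤∣p∣ : ∀ p → - p ≤ ∣ p ∣
-p≤∣p∣ p = subst (- p ≤_) (ℚ.∣-p∣≡∣p∣ p) (p≤∣p∣ (- p))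

∣-∣-swap : ∀ p q → ∣ p - q ∣ ≡ ∣ q - p ∣
∣-∣-swap p q = trans (sym (ℚ.∣-p∣≡∣p∣ (p - q)))
  (cong ∣_∣ (solve 2 (λ p q → :- (p :- q) := q :- p) refl p q))

∣-∣-triangle : ∀ p q r → ∣ p - r ∣ ≤ ∣ p - q ∣ + ∣ q - r ∣
∣-∣-triangle p q r = subst (λ t → ∣ t ∣ ≤ ∣ p - q ∣ + ∣ q - r ∣)
  (solve 3 (λ p q r → (p :- q) :+ (q :- r) := p :- r) refl p q r)
  (ℚ.∣p+q∣≤∣p∣+∣q∣ (p - q) (q - r))

∣-∣⇒≤ : ∀ {p q e} → ∣ p - q ∣ ≤ e → p ≤ q + e
∣-∣⇒≤ {p} {q} {e} h = subst (_≤ q + e)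
  (solve 2 (λ p q → q :+ (p :- q) := p) refl p q)
  (ℚ.+-monoʳ-≤ q (ℚ.≤-trans (p≤∣p∣ (p - q)) h))

≤⇒∣-∣ : ∀ {p q e} → p ≤ q + e → q ≤ p + e → ∣ p - q ∣ ≤ e
≤⇒∣-∣ {p} {q} {e} h k = ∣∣-bound
  (≤-from-diff (q + e - p) (0≤diff h)
    (solve 3 (λ p q e → (p :- q) :+ (q :+ e :- p) := e) refl p q e))
  (≤-from-diff (p + e - q) (0≤diff k)
    (solve 3 (λ p q e → :- (p :- q) :+ (p :+ e :- q) := e) refl p q e))

IsCauchy : (ℕ → ℚ) → Set
IsCauchy x = ∀ ε → 0ℚ < ε → ∃[ N ] (∀ m n → N ℕ.≤ m → N ℕ.≤ n → ∣ x m - x n ∣ ≤ ε)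

-- Reals are Cauchy sequences of rationals, not quotiented.
record ℝ : Set where
  constructor mkℝ
  field
    seq    : ℕ → ℚ
    cauchy : IsCauchy seq

open ℝ public

infix 4 _≤ℝ_ _<ℝ_

_≤ℝ_ : ℝ → ℝ → Set
x ≤ℝ y = ∀ ε → 0ℚ < ε → ∃[ N ] (∀ n → N ℕ.≤ n → seq x n ≤ seq y n + ε)

_<ℝ_ : ℝ → ℝ → Set
x <ℝ y = ∃[ δ ] 0ℚ < δ × ∃[ N ] (∀ n → N ℕ.≤ n → seq x n + δ ≤ seq y n)

fromℚ : ℚ → ℝ
fromℚ q = mkℝ (λ _ → q) λ ε 0<ε → 0 , λ _ _ _ _ →
  ℚ.≤-trans (ℚ.≤-reflexive (cong ∣_∣ (ℚ.+-inverseʳ q))) (ℚ.<⇒≤ 0<ε)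

fromℕ : ℕ → ℝ
fromℕ n = fromℚ (ι n)

0ℝ 1ℝ : ℝ
0ℝ = fromℕ 0
1ℝ = fromℕ 1

cauchy-scaled : ∀ (x : ℕ → ℚ) K → 0ℚ < K →
  (∀ ε → 0ℚ < ε → ∃[ N ] (∀ m n → N ℕ.≤ m → N ℕ.≤ n → ∣ x m - x n ∣ ≤ K * ε)) →
  IsCauchy x
cauchy-scaled x K 0<K h ε 0<ε with h (ε * inv K) (*-pos 0<ε (0<inv 0<K))
... | N , bound = N , λ m n N≤m N≤n → subst (_ ≤_) K*ε/K≡ε (bound m n N≤m N≤n)
  where
  K*ε/K≡ε : K * (ε * inv K) ≡ ε
  K*ε/K≡ε = trans (solve 3 (λ k e i → k :* (e :* i) := k :* i :* e) refl K ε (inv K))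
    (trans (cong (_* ε) (*-inv 0<K)) (ℚ.*-identityˡ ε))

bounded : ∀ x → ∃[ B ] 0ℚ < B × ∃[ N ] (∀ n → N ℕ.≤ n → ∣ seq x n ∣ ≤ B)
bounded x with cauchy x 1ℚ 0<1
... | N , close = ∣ seq x N ∣ + 1ℚ
    , ℚ.≤-<-trans (ℚ.0≤∣p∣ (seq x N)) (p<p+1 ∣ seq x N ∣) , N , λ n N≤n →
  ℚ.≤-trans (ℚ.≤-reflexive (cong ∣_∣ (eq (seq x n) (seq x N))))
    (ℚ.≤-trans (ℚ.∣p+q∣≤∣p∣+∣q∣ (seq x N) (seq x n - seq x N))
      (ℚ.+-monoʳ-≤ ∣ seq x N ∣ (close n N N≤n ℕ.≤-refl)))
  where
  eq : ∀ p q → p ≡ q + (p - q)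
  eq = solve 2 (λ p q → p := q :+ (p :- q)) refl

m≤o₁ : ∀ m n {o} → m ℕ.⊔ n ℕ.≤ o → m ℕ.≤ o
m≤o₁ m n = ℕ.m⊔n≤o⇒m≤o m n

m≤o₂ : ∀ m n {o} → m ℕ.⊔ n ℕ.≤ o → n ℕ.≤ o
m≤o₂ m n = ℕ.m⊔n≤o⇒n≤o m n

infixl 7 _*ℝ_
_*ℝ_ : ℝ → ℝ → ℝ
x *ℝ y = mkℝ (λ n → seq x n * seq y n) (cauchy-* (bounded x) (bounded y))
  where
  cauchy-* : (∃[ B ] 0ℚ < B × ∃[ N ] (∀ n → N ℕ.≤ n → ∣ seq x n ∣ ≤ B)) →
             (∃[ C ] 0ℚ < C × ∃[ N ] (∀ n → N ℕ.≤ n → ∣ seq y n ∣ ≤ C)) →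
             IsCauchy (λ n → seq x n * seq y n)
  cauchy-* (B , 0<B , M₁ , x≤B) (C , 0<C , M₂ , y≤C) =
    cauchy-scaled (λ n → seq x n * seq y n) (B + C) (ℚ.+-mono-< 0<B 0<C) step
    where
    step : ∀ ε → 0ℚ < ε → ∃[ N ] (∀ m n → N ℕ.≤ m → N ℕ.≤ n →
      ∣ seq x m * seq y m - seq x n * seq y n ∣ ≤ (B + C) * ε)
    step ε 0<ε with cauchy x ε 0<ε | cauchy y ε 0<ε
    ... | N₁ , close-x | N₂ , close-y = (M₁ ℕ.⊔ M₂) ℕ.⊔ (N₁ ℕ.⊔ N₂) , λ m n hm hn →
      subst₂ _≤_ (cong ∣_∣ (split (seq x m) (seq x n) (seq y m) (seq y n)))
                 (sym (ℚ.*-distribʳ-+ ε B C))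
        (ℚ.≤-trans (ℚ.∣p+q∣≤∣p∣+∣q∣ (seq x m * (seq y m - seq y n)) (seq y n * (seq x m - seq x n)))
          (ℚ.+-mono-≤
            (product≤ (seq x m) (x≤B m (m≤o₁ M₁ M₂ (m≤o₁ (M₁ ℕ.⊔ M₂) (N₁ ℕ.⊔ N₂) hm)))
                      (close-y m n (m≤o₂ N₁ N₂ (m≤o₂ (M₁ ℕ.⊔ M₂) (N₁ ℕ.⊔ N₂) hm)) (m≤o₂ N₁ N₂ (m≤o₂ (M₁ ℕ.⊔ M₂) (N₁ ℕ.⊔ N₂) hn))))
            (product≤ (seq y n) (y≤C n (m≤o₂ M₁ M₂ (m≤o₁ (M₁ ℕ.⊔ M₂) (N₁ ℕ.⊔ N₂) hn)))
                      (close-x m n (m≤o₁ N₁ N₂ (m≤o₂ (M₁ ℕ.⊔ M₂) (N₁ ℕ.⊔ N₂) hm)) (m≤o₁ N₁ N₂ (m≤o₂ (M₁ ℕ.⊔ M₂) (N₁ ℕ.⊔ N₂) hn))))))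
      where
      split : ∀ a b c d → a * (c - d) + d * (a - b) ≡ a * c - b * d
      split = solve 4 (λ a b c d → a :* (c :- d) :+ d :* (a :- b) := a :* c :- b :* d) refl
      product≤ : ∀ p {q P} → ∣ p ∣ ≤ P → ∣ q ∣ ≤ ε → ∣ p * q ∣ ≤ P * ε
      product≤ p {q} p≤P q≤ε = subst (_≤ _) (sym (ℚ.∣p*q∣≡∣p∣*∣q∣ p q))
        (*-mono (ℚ.0≤∣p∣ p) p≤P (ℚ.0≤∣p∣ q) q≤ε)

-- Eventually bounded below by a positive rational.
eventually-positive : ∀ x → 0ℝ <ℝ x → ∃[ δ ] 0ℚ < δ × ∃[ N ] (∀ n → N ℕ.≤ n → δ ≤ seq x n)
eventually-positive x (δ , 0<δ , N , h) =
  δ , 0<δ , N , λ n N≤n → subst (_≤ seq x n) (ℚ.+-identityˡ δ) (h n N≤n)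

inv-lipschitz : ∀ {δ p q} → 0ℚ < δ → δ ≤ p → δ ≤ q →
                ∣ inv p - inv q ∣ ≤ inv δ * inv δ * ∣ p - q ∣
inv-lipschitz {δ} {p} {q} 0<δ δ≤p δ≤q = begin
  ∣ inv p - inv q ∣                 ≡⟨ cong ∣_∣ (inv-diff 0<p 0<q) ⟩
  ∣ (q - p) * (inv p * inv q) ∣     ≡⟨ ℚ.∣p*q∣≡∣p∣*∣q∣ (q - p) (inv p * inv q) ⟩
  ∣ q - p ∣ * ∣ inv p * inv q ∣     ≡⟨ cong (∣ q - p ∣ *_) (ℚ.0≤p⇒∣p∣≡p 0≤ij) ⟩
  ∣ q - p ∣ * (inv p * inv q)       ≡⟨ ℚ.*-comm ∣ q - p ∣ (inv p * inv q) ⟩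
  inv p * inv q * ∣ q - p ∣         ≤⟨ *-monoʳ (ℚ.0≤∣p∣ (q - p))
                                        (*-mono (0≤inv 0<p) (inv-anti 0<δ δ≤p)
                                                (0≤inv 0<q) (inv-anti 0<δ δ≤q)) ⟩
  inv δ * inv δ * ∣ q - p ∣         ≡⟨ cong (inv δ * inv δ *_) (∣-∣-swap q p) ⟩
  inv δ * inv δ * ∣ p - q ∣         ∎
  where
  open ℚ.≤-Reasoning
  0<p : 0ℚ < p
  0<p = ℚ.<-≤-trans 0<δ δ≤p
  0<q : 0ℚ < q
  0<q = ℚ.<-≤-trans 0<δ δ≤q
  0≤ij : 0ℚ ≤ inv p * inv q
  0≤ij = *-nonNeg (0≤inv 0<p) (0≤inv 0<q)

reciprocal : (x : ℝ) → 0ℝ <ℝ x → ℝ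
reciprocal x 0<x = mkℝ (inv ∘ seq x) (cauchy-inv (eventually-positive x 0<x))
  where
  cauchy-inv : (∃[ δ ] 0ℚ < δ × ∃[ N ] (∀ n → N ℕ.≤ n → δ ≤ seq x n)) → IsCauchy (inv ∘ seq x)
  cauchy-inv (δ , 0<δ , M , δ≤x) = cauchy-scaled (inv ∘ seq x) (inv δ * inv δ) 0<K step
    where
    0<K : 0ℚ < inv δ * inv δ
    0<K = *-pos (0<inv 0<δ) (0<inv 0<δ)
    step : ∀ ε → 0ℚ < ε → ∃[ N ] (∀ m n → N ℕ.≤ m → N ℕ.≤ n →
      ∣ inv (seq x m) - inv (seq x n) ∣ ≤ inv δ * inv δ * ε)
    step ε 0<ε with cauchy x ε 0<ε
    ... | N , close = M ℕ.⊔ N , λ m n hm hn →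
      ℚ.≤-trans (inv-lipschitz 0<δ (δ≤x m (m≤o₁ M N hm)) (δ≤x n (m≤o₁ M N hn)))
        (ℚ.*-monoˡ-≤-nonNeg (inv δ * inv δ) {{ℚ.nonNegative (ℚ.<⇒≤ 0<K)}}
          (close m n (m≤o₂ M N hm) (m≤o₂ M N hn)))

divide : (x y : ℝ) → 0ℝ <ℝ y → ℝ
divide x y 0<y = x *ℝ reciprocal y 0<y

-- The largest j/(n+1) with j ≤ bound whose square is at most q, or 0 if there is none.
gridRoot : ℕ → ℕ → ℚ → ℚ
gridRoot bound n q =
  ι (greatest (λ j → (ι j * inv (ι (suc n))) * (ι j * inv (ι (suc n))) ℚ.≤? q) bound)
  * inv (ι (suc n))

-- The bound is large enough for gridRoot to be √q rounded down to a multiple of 1/(n+1).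
sqrtBelow : ℕ → ℚ → ℚ
sqrtBelow n q = gridRoot ((ℤ.∣ ↥ q ∣ ℕ.+ 1) ℕ.* suc n) n q

0≤gridRoot : ∀ bound n q → 0ℚ ≤ gridRoot bound n q
0≤gridRoot bound n q = *-nonNeg
  (0≤ι (greatest (λ j → (ι j * inv (ι (suc n))) * (ι j * inv (ι (suc n))) ℚ.≤? q) bound))
  (0≤inv (0<ι n))

gridRoot-lower : ∀ bound n q → 0ℚ < gridRoot bound n q →
                 gridRoot bound n q * gridRoot bound n q ≤ q
gridRoot-lower bound n q 0<s with greatest-holds-or-zero
  (λ j → (ι j * inv (ι (suc n))) * (ι j * inv (ι (suc n))) ℚ.≤? q) bound
... | inj₂ holds = holds
... | inj₁ g≡0   = contradiction
  (subst (0ℚ <_) (trans (cong (λ g → ι g * inv (ι (suc n))) g≡0) (ℚ.*-zeroˡ (inv (ι (suc n))))) 0<s)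
  (ℚ.<-irrefl refl)

gridRoot-upper : ∀ bound n q b → 1ℚ ≤ b → q < b → b ≡ ι bound * inv (ι (suc n)) →
  q < (gridRoot bound n q + inv (ι (suc n))) * (gridRoot bound n q + inv (ι (suc n)))
gridRoot-upper bound n q b 1≤b q<b b≡ =
  subst (λ t → q < t * t) 1+g≡ (q<square (suc g ℕ.≤? bound))
  where
  i : ℚ
  i = inv (ι (suc n))
  P? : Decidable (λ j → (ι j * i) * (ι j * i) ≤ q)
  P? j = (ι j * i) * (ι j * i) ℚ.≤? q
  g : ℕ
  g = greatest P? bound
  1+g≡ : ι (suc g) * i ≡ ι g * i + i
  1+g≡ = trans (cong (_* i) (ι-suc g))
    (solve 2 (λ g i → (g :+ con 1ℚ) :* i := g :* i :+ i) refl (ι g) i)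
  0≤b : 0ℚ ≤ b
  0≤b = ℚ.≤-trans (ℚ.<⇒≤ 0<1) 1≤b
  q<square : Dec (suc g ℕ.≤ bound) → q < (ι (suc g) * i) * (ι (suc g) * i)
  q<square (yes 1+g≤bound) = ℚ.≰⇒> λ p → ℕ.1+n≰n (greatest-upper P? bound (suc g) 1+g≤bound p)
  q<square (no 1+g≰bound) = ℚ.<-≤-trans q<b (ℚ.≤-trans
    (ℚ.≤-trans (ℚ.≤-reflexive (sym (ℚ.*-identityˡ b))) (*-monoʳ 0≤b 1≤b))
    (*-mono 0≤b b≤ 0≤b b≤))
    where
    b≤ : b ≤ ι (suc g) * i
    b≤ = subst (_≤ ι (suc g) * i) (sym b≡) (*-monoʳ (0≤inv (0<ι n))
      (ι-mono {bound} {suc g} (ℕ.≤-trans (ℕ.≮⇒≥ 1+g≰bound) (ℕ.n≤1+n g))))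

0≤sqrtBelow : ∀ n q → 0ℚ ≤ sqrtBelow n q
0≤sqrtBelow n q = 0≤gridRoot ((ℤ.∣ ↥ q ∣ ℕ.+ 1) ℕ.* suc n) n q

sqrtBelow-lower : ∀ n q → 0ℚ < sqrtBelow n q → sqrtBelow n q * sqrtBelow n q ≤ q
sqrtBelow-lower n q = gridRoot-lower ((ℤ.∣ ↥ q ∣ ℕ.+ 1) ℕ.* suc n) n q

sqrtBelow-upper : ∀ n q →
  q < (sqrtBelow n q + inv (ι (suc n))) * (sqrtBelow n q + inv (ι (suc n)))
sqrtBelow-upper n q = gridRoot-upper (c ℕ.* suc n) n q (ι c)
  (ι-mono {1} {c} (ℕ.m≤n+m 1 ℤ.∣ ↥ q ∣))
  (ℚ.≤-<-trans (q≤ι q) (subst (ι ℤ.∣ ↥ q ∣ <_)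
    (trans (sym (ι-suc ℤ.∣ ↥ q ∣)) (cong ι (ℕ.+-comm 1 ℤ.∣ ↥ q ∣))) (p<p+1 (ι ℤ.∣ ↥ q ∣))))
  (sym (trans (cong (_* inv (ι (suc n))) (ι-* c (suc n)))
    (trans (ℚ.*-assoc (ι c) (ι (suc n)) (inv (ι (suc n))))
      (trans (cong (ι c *_) (*-inv (0<ι n))) (ℚ.*-identityʳ (ι c))))))
  where
  c : ℕ
  c = ℤ.∣ ↥ q ∣ ℕ.+ 1

reciprocal-small : ∀ ε → 0ℚ < ε → ∃[ N ] (∀ n → N ℕ.≤ n → inv (ι (suc n)) ≤ ε)
reciprocal-small ε 0<ε = ℤ.∣ ↥ inv ε ∣ , λ n N≤n → begin
  inv (ι (suc n))                   ≡⟨ sym (ℚ.*-identityˡ (inv (ι (suc n)))) ⟩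
  1ℚ * inv (ι (suc n))              ≡⟨ cong (_* inv (ι (suc n))) (sym (*-inv 0<ε)) ⟩
  ε * inv ε * inv (ι (suc n))       ≤⟨ *-monoʳ (0≤inv (0<ι n))
                                        (ℚ.*-monoˡ-≤-nonNeg ε {{ℚ.nonNegative (ℚ.<⇒≤ 0<ε)}}
                                          (ℚ.≤-trans (q≤ι (inv ε))
                                            (ι-mono (ℕ.≤-trans N≤n (ℕ.n≤1+n n))))) ⟩
  ε * ι (suc n) * inv (ι (suc n))   ≡⟨ ℚ.*-assoc ε (ι (suc n)) (inv (ι (suc n))) ⟩
  ε * (ι (suc n) * inv (ι (suc n))) ≡⟨ cong (ε *_) (*-inv (0<ι n)) ⟩
  ε * 1ℚ                            ≡⟨ ℚ.*-identityʳ ε ⟩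
  ε                                 ∎
  where open ℚ.≤-Reasoning

-- Square root of max(x, 0).
infix 8 √_
√_ : ℝ → ℝ
√ x = mkℝ (λ n → sqrtBelow n (seq x n))
          (cauchy-scaled (λ n → sqrtBelow n (seq x n)) (ι 2) (0<ι 1) step)
  where
  half-close : ∀ {ε m n} → 0ℚ < ε → ∣ seq x m - seq x n ∣ ≤ ε * ε → inv (ι (suc n)) ≤ ε →
    sqrtBelow m (seq x m) ≤ sqrtBelow n (seq x n) + ι 2 * ε
  half-close {ε} {m} {n} 0<ε a≈b i≤ε with sqrtBelow m (seq x m) ℚ.≤? sqrtBelow n (seq x n) + inv (ι (suc n)) + ε
  ... | yes u≤ = ℚ.≤-trans u≤ (≤-from-diff (ε - inv (ι (suc n))) (0≤diff i≤ε)
        (solve 3 (λ v i e → v :+ i :+ e :+ (e :- i) := v :+ con (ι 2) :* e) refl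
          (sqrtBelow n (seq x n)) (inv (ι (suc n))) ε))
  ... | no u≰ = contradiction (begin-strict
      a                                     ≤⟨ ∣-∣⇒≤ a≈b ⟩
      b + ε * ε                             <⟨ ℚ.+-monoˡ-< (ε * ε) (sqrtBelow-upper n b) ⟩
      (v + i) * (v + i) + ε * ε             ≤⟨ ≤-from-diff (ι 2 * ((v + i) * ε))
                                                (*-nonNeg (0≤ι 2) (*-nonNeg 0≤v+i (ℚ.<⇒≤ 0<ε)))
                                                (solve 2 (λ w e → w :* w :+ e :* e :+ con (ι 2) :* (w :* e)
                                                   := (w :+ e) :* (w :+ e)) refl (v + i) ε) ⟩
      (v + i + ε) * (v + i + ε)             ≤⟨ *-mono 0≤w w≤u 0≤w w≤u ⟩
      u * u                                 ≤⟨ sqrtBelow-lower m a (ℚ.≤-<-trans 0≤w (ℚ.≰⇒> u≰)) ⟩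
      a                                     ∎) (ℚ.<-irrefl refl)
    where
    open ℚ.≤-Reasoning
    a b u v i : ℚ
    a = seq x m
    b = seq x n
    u = sqrtBelow m a
    v = sqrtBelow n b
    i = inv (ι (suc n))
    0≤v+i : 0ℚ ≤ v + i
    0≤v+i = +-nonNeg (0≤sqrtBelow n b) (0≤inv (0<ι n))
    0≤w : 0ℚ ≤ v + i + ε
    0≤w = +-nonNeg 0≤v+i (ℚ.<⇒≤ 0<ε)
    w≤u : v + i + ε ≤ u
    w≤u = ℚ.<⇒≤ (ℚ.≰⇒> u≰)
  step : ∀ ε → 0ℚ < ε → ∃[ N ] (∀ m n → N ℕ.≤ m → N ℕ.≤ n →
    ∣ sqrtBelow m (seq x m) - sqrtBelow n (seq x n) ∣ ≤ ι 2 * ε)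
  step ε 0<ε with cauchy x (ε * ε) (*-pos 0<ε 0<ε) | reciprocal-small ε 0<ε
  ... | N₁ , close | N₂ , small = N₁ ℕ.⊔ N₂ , λ m n hm hn → ≤⇒∣-∣
    (half-close 0<ε (close m n (m≤o₁ N₁ N₂ hm) (m≤o₁ N₁ N₂ hn)) (small n (m≤o₂ N₁ N₂ hn)))
    (half-close 0<ε (close n m (m≤o₁ N₁ N₂ hn) (m≤o₁ N₁ N₂ hm)) (small m (m≤o₂ N₁ N₂ hm)))

-- ln q = 2 artanh z = Σ_k 2 z^(2k+1) / (2k+1) with z = (q-1)/(q+1), convergent for every q > 0.
atanhArg : ℚ → ℚ
atanhArg q = (q - 1ℚ) * inv (q + 1ℚ)

atanhTerm : ℕ → ℚ → ℚ
atanhTerm k z = ι 2 * (z ^ suc (2 ℕ.* k)) * inv (ι (suc (2 ℕ.* k)))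

atanhSum : ℕ → ℚ → ℚ
atanhSum zero    z = 0ℚ
atanhSum (suc N) z = atanhSum N z + atanhTerm N z

^-nonNeg : ∀ {r} → 0ℚ ≤ r → ∀ k → 0ℚ ≤ r ^ k
^-nonNeg 0≤r zero    = ℚ.<⇒≤ 0<1
^-nonNeg 0≤r (suc k) = *-nonNeg 0≤r (^-nonNeg 0≤r k)

^-mono : ∀ {r s} → 0ℚ ≤ r → r ≤ s → ∀ k → r ^ k ≤ s ^ k
^-mono 0≤r r≤s zero    = ℚ.≤-refl
^-mono 0≤r r≤s (suc k) = *-mono 0≤r r≤s (^-nonNeg 0≤r k) (^-mono 0≤r r≤s k)

∣^∣ : ∀ {z r} → ∣ z ∣ ≤ r → ∀ k → ∣ z ^ k ∣ ≤ r ^ k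
∣^∣ ∣z∣≤r zero = ℚ.≤-refl
∣^∣ {z} {r} ∣z∣≤r (suc k) = subst (_≤ r * r ^ k) (sym (ℚ.∣p*q∣≡∣p∣*∣q∣ z (z ^ k)))
  (*-mono (ℚ.0≤∣p∣ z) ∣z∣≤r (ℚ.0≤∣p∣ (z ^ k)) (∣^∣ ∣z∣≤r k))

^-anti : ∀ {r} → 0ℚ ≤ r → r ≤ 1ℚ → ∀ i k → r ^ (i ℕ.+ k) ≤ r ^ k
^-anti 0≤r r≤1 zero    k = ℚ.≤-refl
^-anti {r} 0≤r r≤1 (suc i) k = ℚ.≤-trans
  (subst (r * r ^ (i ℕ.+ k) ≤_) (ℚ.*-identityˡ (r ^ (i ℕ.+ k)))
    (*-monoʳ (^-nonNeg 0≤r (i ℕ.+ k)) r≤1))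
  (^-anti 0≤r r≤1 i k)

^-lipschitz : ∀ {z w r} → 0ℚ ≤ r → ∣ z ∣ ≤ r → ∣ w ∣ ≤ r → ∀ j →
              ∣ z ^ suc j - w ^ suc j ∣ ≤ ι (suc j) * r ^ j * ∣ z - w ∣
^-lipschitz {z} {w} 0≤r ∣z∣≤r ∣w∣≤r zero = ℚ.≤-reflexive (trans
  (cong ∣_∣ (solve 2 (λ z w → z :* con 1ℚ :- w :* con 1ℚ := z :- w) refl z w))
  (sym (ℚ.*-identityˡ ∣ z - w ∣)))
^-lipschitz {z} {w} {r} 0≤r ∣z∣≤r ∣w∣≤r (suc j) = begin
  ∣ z * z ^ suc j - w * w ^ suc j ∣
    ≡⟨ cong ∣_∣ (solve 4 (λ z w p q → z :* p :- w :* q := z :* (p :- q) :+ q :* (z :- w))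
                         refl z w (z ^ suc j) (w ^ suc j)) ⟩
  ∣ z * (z ^ suc j - w ^ suc j) + w ^ suc j * (z - w) ∣
    ≤⟨ ℚ.∣p+q∣≤∣p∣+∣q∣ (z * (z ^ suc j - w ^ suc j)) (w ^ suc j * (z - w)) ⟩
  ∣ z * (z ^ suc j - w ^ suc j) ∣ + ∣ w ^ suc j * (z - w) ∣
    ≡⟨ cong₂ _+_ (ℚ.∣p*q∣≡∣p∣*∣q∣ z (z ^ suc j - w ^ suc j))
                 (ℚ.∣p*q∣≡∣p∣*∣q∣ (w ^ suc j) (z - w)) ⟩
  ∣ z ∣ * ∣ z ^ suc j - w ^ suc j ∣ + ∣ w ^ suc j ∣ * D
    ≤⟨ ℚ.+-mono-≤
         (*-mono (ℚ.0≤∣p∣ z) ∣z∣≤r (ℚ.0≤∣p∣ (z ^ suc j - w ^ suc j)) (^-lipschitz 0≤r ∣z∣≤r ∣w∣≤r j))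
         (*-monoʳ (ℚ.0≤∣p∣ (z - w)) (∣^∣ ∣w∣≤r (suc j))) ⟩
  r * (ι (suc j) * r ^ j * D) + r * r ^ j * D
    ≡⟨ solve 4 (λ r n p d → r :* (n :* p :* d) :+ r :* p :* d := (n :+ con 1ℚ) :* (r :* p) :* d)
               refl r (ι (suc j)) (r ^ j) D ⟩
  (ι (suc j) + 1ℚ) * (r * r ^ j) * D
    ≡⟨ cong (λ n → n * (r * r ^ j) * D) (sym (ι-suc (suc j))) ⟩
  ι (suc (suc j)) * (r * r ^ j) * D ∎
  where
  open ℚ.≤-Reasoning
  D : ℚ
  D = ∣ z - w ∣

geometric-small : ∀ {r} → 0ℚ ≤ r → r < 1ℚ → ∀ ε → 0ℚ < ε → ∃[ N ] r ^ N ≤ ε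
geometric-small {r} 0≤r r<1 ε 0<ε = N , (begin
  r ^ N                       ≡⟨ sym (ℚ.*-identityʳ (r ^ N)) ⟩
  r ^ N * 1ℚ                  ≡⟨ cong (r ^ N *_) (sym (*-inv (*-pos 0<ε 0<d))) ⟩
  r ^ N * (ε * d * inv (ε * d)) ≤⟨ ℚ.*-monoˡ-≤-nonNeg (r ^ N) {{ℚ.nonNegative (^-nonNeg 0≤r N)}}
                                   (ℚ.*-monoˡ-≤-nonNeg (ε * d) {{ℚ.nonNegative (ℚ.<⇒≤ (*-pos 0<ε 0<d))}}
                                     (q≤ι (inv (ε * d)))) ⟩
  r ^ N * (ε * d * ι N)       ≤⟨ ≤-from-diff (r ^ N * ε) (*-nonNeg (^-nonNeg 0≤r N) (ℚ.<⇒≤ 0<ε))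
                                   (solve 4 (λ p e d n → p :* (e :* d :* n) :+ p :* e
                                     := e :* (p :* (con 1ℚ :+ n :* d))) refl (r ^ N) ε d (ι N)) ⟩
  ε * (r ^ N * (1ℚ + ι N * d)) ≤⟨ ℚ.*-monoˡ-≤-nonNeg ε {{ℚ.nonNegative (ℚ.<⇒≤ 0<ε)}} (bernoulli N) ⟩
  ε * 1ℚ                      ≡⟨ ℚ.*-identityʳ ε ⟩
  ε                           ∎)
  where
  open ℚ.≤-Reasoning
  d : ℚ
  d = 1ℚ - r
  0<d : 0ℚ < d
  0<d = subst (_< d) (ℚ.+-inverseʳ r) (ℚ.+-monoˡ-< (- r) r<1)
  N : ℕ
  N = ℤ.∣ ↥ inv (ε * d) ∣
  bernoulli : ∀ M → r ^ M * (1ℚ + ι M * d) ≤ 1ℚ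
  bernoulli zero = ℚ.≤-reflexive (trans (ℚ.*-identityˡ (1ℚ + 0ℚ * d))
    (trans (cong (λ t → 1ℚ + t) (ℚ.*-zeroˡ d)) (ℚ.+-identityʳ 1ℚ)))
  bernoulli (suc M) = ℚ.≤-trans
    (≤-from-diff (p * (ι M + 1ℚ) * (d * d))
      (*-nonNeg (*-nonNeg (^-nonNeg 0≤r M) (+-nonNeg (0≤ι M) (ℚ.<⇒≤ 0<1)))
                (*-nonNeg (ℚ.<⇒≤ 0<d) (ℚ.<⇒≤ 0<d)))
      (trans (cong (λ n → r * p * (1ℚ + n * d) + p * (ι M + 1ℚ) * (d * d)) (ι-suc M))
        (solve 3 (λ r p n → r :* p :* (con 1ℚ :+ (n :+ con 1ℚ) :* (con 1ℚ :- r))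
                    :+ p :* (n :+ con 1ℚ) :* ((con 1ℚ :- r) :* (con 1ℚ :- r))
                    := p :* (con 1ℚ :+ n :* (con 1ℚ :- r))) refl r p (ι M))))
    (bernoulli M)
    where
    p : ℚ
    p = r ^ M

-- On ∣z∣ ≤ r < 1 the partial sums are uniformly Lipschitz and uniformly Cauchy.
module _ {r} (0≤r : 0ℚ ≤ r) (r<1 : r < 1ℚ) where

  0≤1-r : 0ℚ ≤ 1ℚ - r
  0≤1-r = 0≤diff (ℚ.<⇒≤ r<1)

  ^2k≤ : ∀ k → r ^ (2 ℕ.* k) ≤ r ^ k
  ^2k≤ k = subst (λ j → r ^ (k ℕ.+ j) ≤ r ^ k) (sym (ℕ.+-identityʳ k))
    (^-anti 0≤r (ℚ.<⇒≤ r<1) k k)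

  term-lipschitz : ∀ {z w} → ∣ z ∣ ≤ r → ∣ w ∣ ≤ r → ∀ k →
    ∣ atanhTerm k z - atanhTerm k w ∣ ≤ ι 2 * ∣ z - w ∣ * r ^ k
  term-lipschitz {z} {w} ∣z∣≤r ∣w∣≤r k = begin
    ∣ ι 2 * p * i - ι 2 * q * i ∣
      ≡⟨ cong ∣_∣ (solve 3 (λ p q i → con (ι 2) :* p :* i :- con (ι 2) :* q :* i
                                   := (con (ι 2) :* i) :* (p :- q)) refl p q i) ⟩
    ∣ (ι 2 * i) * (p - q) ∣
      ≡⟨ ℚ.∣p*q∣≡∣p∣*∣q∣ (ι 2 * i) (p - q) ⟩
    ∣ ι 2 * i ∣ * ∣ p - q ∣
      ≡⟨ cong (_* ∣ p - q ∣) (ℚ.0≤p⇒∣p∣≡p 0≤2i) ⟩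
    ι 2 * i * ∣ p - q ∣
      ≤⟨ ℚ.*-monoˡ-≤-nonNeg (ι 2 * i) {{ℚ.nonNegative 0≤2i}} (^-lipschitz 0≤r ∣z∣≤r ∣w∣≤r (2 ℕ.* k)) ⟩
    ι 2 * i * (n * r ^ (2 ℕ.* k) * D)
      ≡⟨ solve 4 (λ i n a d → con (ι 2) :* i :* (n :* a :* d) := (n :* i) :* (con (ι 2) :* d :* a))
                 refl i n (r ^ (2 ℕ.* k)) D ⟩
    (n * i) * (ι 2 * D * r ^ (2 ℕ.* k))
      ≡⟨ trans (cong (_* (ι 2 * D * r ^ (2 ℕ.* k))) (*-inv (0<ι (2 ℕ.* k)))) (ℚ.*-identityˡ (ι 2 * D * r ^ (2 ℕ.* k))) ⟩
    ι 2 * D * r ^ (2 ℕ.* k)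
      ≤⟨ ℚ.*-monoˡ-≤-nonNeg (ι 2 * D) {{ℚ.nonNegative (*-nonNeg (0≤ι 2) (ℚ.0≤∣p∣ (z - w)))}} (^2k≤ k) ⟩
    ι 2 * D * r ^ k ∎
    where
    open ℚ.≤-Reasoning
    n i p q D : ℚ
    n = ι (suc (2 ℕ.* k))
    i = inv n
    p = z ^ suc (2 ℕ.* k)
    q = w ^ suc (2 ℕ.* k)
    D = ∣ z - w ∣
    0≤2i : 0ℚ ≤ ι 2 * i
    0≤2i = *-nonNeg (0≤ι 2) (0≤inv (0<ι (2 ℕ.* k)))

  sum-lipschitz : ∀ {z w} → ∣ z ∣ ≤ r → ∣ w ∣ ≤ r → ∀ N →
    (1ℚ - r) * ∣ atanhSum N z - atanhSum N w ∣ ≤ ι 2 * ∣ z - w ∣ * (1ℚ - r ^ N)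
  sum-lipschitz {z} {w} ∣z∣≤r ∣w∣≤r zero = ℚ.≤-reflexive (trans (ℚ.*-zeroʳ (1ℚ - r))
    (sym (ℚ.*-zeroʳ (ι 2 * ∣ z - w ∣))))
  sum-lipschitz {z} {w} ∣z∣≤r ∣w∣≤r (suc N) = begin
    (1ℚ - r) * ∣ (s + a) - (t + b) ∣
      ≡⟨ cong (λ x → (1ℚ - r) * ∣ x ∣)
           (solve 4 (λ s a t b → (s :+ a) :- (t :+ b) := (s :- t) :+ (a :- b)) refl s a t b) ⟩
    (1ℚ - r) * ∣ (s - t) + (a - b) ∣
      ≤⟨ ℚ.*-monoˡ-≤-nonNeg (1ℚ - r) {{ℚ.nonNegative 0≤1-r}}
           (ℚ.≤-trans (ℚ.∣p+q∣≤∣p∣+∣q∣ (s - t) (a - b))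
                      (ℚ.+-monoʳ-≤ ∣ s - t ∣ (term-lipschitz ∣z∣≤r ∣w∣≤r N))) ⟩
    (1ℚ - r) * (∣ s - t ∣ + E * r ^ N)
      ≡⟨ ℚ.*-distribˡ-+ (1ℚ - r) ∣ s - t ∣ (E * r ^ N) ⟩
    (1ℚ - r) * ∣ s - t ∣ + (1ℚ - r) * (E * r ^ N)
      ≤⟨ ℚ.+-monoˡ-≤ ((1ℚ - r) * (E * r ^ N)) (sum-lipschitz ∣z∣≤r ∣w∣≤r N) ⟩
    E * (1ℚ - r ^ N) + (1ℚ - r) * (E * r ^ N)
      ≡⟨ solve 3 (λ e r p → e :* (con 1ℚ :- p) :+ (con 1ℚ :- r) :* (e :* p)
                         := e :* (con 1ℚ :- r :* p)) refl E r (r ^ N) ⟩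
    E * (1ℚ - r * r ^ N) ∎
    where
    open ℚ.≤-Reasoning
    s t a b E : ℚ
    s = atanhSum N z
    t = atanhSum N w
    a = atanhTerm N z
    b = atanhTerm N w
    E = ι 2 * ∣ z - w ∣

  ∣term∣≤ : ∀ {z} → ∣ z ∣ ≤ r → ∀ k → ∣ atanhTerm k z ∣ ≤ ι 2 * r ^ k
  ∣term∣≤ {z} ∣z∣≤r k = begin
    ∣ ι 2 * p * i ∣          ≡⟨ ℚ.∣p*q∣≡∣p∣*∣q∣ (ι 2 * p) i ⟩
    ∣ ι 2 * p ∣ * ∣ i ∣      ≡⟨ cong₂ _*_ (ℚ.∣p*q∣≡∣p∣*∣q∣ (ι 2) p)
                                          (ℚ.0≤p⇒∣p∣≡p (0≤inv (0<ι (2 ℕ.* k)))) ⟩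
    ι 2 * ∣ p ∣ * i          ≤⟨ *-mono (*-nonNeg (0≤ι 2) (ℚ.0≤∣p∣ p))
                                  (ℚ.*-monoˡ-≤-nonNeg (ι 2)
                                    (ℚ.≤-trans (∣^∣ ∣z∣≤r (suc (2 ℕ.* k)))
                                      (ℚ.≤-trans (^-anti 0≤r (ℚ.<⇒≤ r<1) 1 (2 ℕ.* k)) (^2k≤ k))))
                                  (0≤inv (0<ι (2 ℕ.* k)))
                                  (inv-anti 0<1 (ι-mono {1} {suc (2 ℕ.* k)} (ℕ.s≤s ℕ.z≤n))) ⟩
    ι 2 * r ^ k * 1ℚ         ≡⟨ ℚ.*-identityʳ (ι 2 * r ^ k) ⟩
    ι 2 * r ^ k              ∎
    where
    open ℚ.≤-Reasoning
    p i : ℚ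
    p = z ^ suc (2 ℕ.* k)
    i = inv (ι (suc (2 ℕ.* k)))

  tail : ∀ {z} → ∣ z ∣ ≤ r → ∀ N j →
    (1ℚ - r) * ∣ atanhSum (j ℕ.+ N) z - atanhSum N z ∣ ≤ ι 2 * (r ^ N - r ^ (j ℕ.+ N))
  tail {z} ∣z∣≤r N zero = ℚ.≤-reflexive (trans
    (trans (cong (λ x → (1ℚ - r) * ∣ x ∣) (ℚ.+-inverseʳ (atanhSum N z))) (ℚ.*-zeroʳ (1ℚ - r)))
    (sym (trans (cong (ι 2 *_) (ℚ.+-inverseʳ (r ^ N))) (ℚ.*-zeroʳ (ι 2)))))
  tail {z} ∣z∣≤r N (suc j) = begin
    (1ℚ - r) * ∣ (s + a) - t ∣
      ≡⟨ cong (λ x → (1ℚ - r) * ∣ x ∣)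
           (solve 3 (λ s a t → (s :+ a) :- t := (s :- t) :+ a) refl s a t) ⟩
    (1ℚ - r) * ∣ (s - t) + a ∣
      ≤⟨ ℚ.*-monoˡ-≤-nonNeg (1ℚ - r) {{ℚ.nonNegative 0≤1-r}}
           (ℚ.≤-trans (ℚ.∣p+q∣≤∣p∣+∣q∣ (s - t) a) (ℚ.+-monoʳ-≤ ∣ s - t ∣ (∣term∣≤ ∣z∣≤r (j ℕ.+ N)))) ⟩
    (1ℚ - r) * (∣ s - t ∣ + ι 2 * p)
      ≡⟨ ℚ.*-distribˡ-+ (1ℚ - r) ∣ s - t ∣ (ι 2 * p) ⟩
    (1ℚ - r) * ∣ s - t ∣ + (1ℚ - r) * (ι 2 * p)
      ≤⟨ ℚ.+-monoˡ-≤ ((1ℚ - r) * (ι 2 * p)) (tail ∣z∣≤r N j) ⟩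
    ι 2 * (r ^ N - p) + (1ℚ - r) * (ι 2 * p)
      ≡⟨ solve 3 (λ q p r → con (ι 2) :* (q :- p) :+ (con 1ℚ :- r) :* (con (ι 2) :* p)
                         := con (ι 2) :* (q :- r :* p)) refl (r ^ N) p r ⟩
    ι 2 * (r ^ N - r * p) ∎
    where
    open ℚ.≤-Reasoning
    s t a p : ℚ
    s = atanhSum (j ℕ.+ N) z
    t = atanhSum N z
    a = atanhTerm (j ℕ.+ N) z
    p = r ^ (j ℕ.+ N)

  tail≤ : ∀ {z} → ∣ z ∣ ≤ r → ∀ N m → N ℕ.≤ m →
    (1ℚ - r) * ∣ atanhSum m z - atanhSum N z ∣ ≤ ι 2 * r ^ N
  tail≤ {z} ∣z∣≤r N m N≤m = ℚ.≤-trans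
    (subst (λ k → (1ℚ - r) * ∣ atanhSum k z - atanhSum N z ∣ ≤ ι 2 * (r ^ N - r ^ k))
           (ℕ.m∸n+n≡m N≤m) (tail ∣z∣≤r N (m ℕ.∸ N)))
    (≤-from-diff (ι 2 * r ^ m) (*-nonNeg (0≤ι 2) (^-nonNeg 0≤r m))
      (solve 2 (λ p q → con (ι 2) :* (p :- q) :+ con (ι 2) :* q := con (ι 2) :* p) refl (r ^ N) (r ^ m)))

  sum-close : ∀ {z w} → ∣ z ∣ ≤ r → ∣ w ∣ ≤ r → ∀ N m n → N ℕ.≤ m → N ℕ.≤ n →
    (1ℚ - r) * ∣ atanhSum m z - atanhSum n w ∣ ≤ ι 4 * r ^ N + ι 2 * ∣ z - w ∣
  sum-close {z} {w} ∣z∣≤r ∣w∣≤r N m n N≤m N≤n = begin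
    d * ∣ a - b ∣
      ≤⟨ ℚ.*-monoˡ-≤-nonNeg d {{ℚ.nonNegative 0≤1-r}}
           (ℚ.≤-trans (∣-∣-triangle a s b) (ℚ.+-monoʳ-≤ ∣ a - s ∣ (∣-∣-triangle s t b))) ⟩
    d * (∣ a - s ∣ + (∣ s - t ∣ + ∣ t - b ∣))
      ≡⟨ solve 4 (λ d x y z → d :* (x :+ (y :+ z)) := d :* x :+ (d :* y :+ d :* z))
                 refl d (∣ a - s ∣) (∣ s - t ∣) (∣ t - b ∣) ⟩
    d * ∣ a - s ∣ + (d * ∣ s - t ∣ + d * ∣ t - b ∣)
      ≡⟨ cong (λ x → d * ∣ a - s ∣ + (d * ∣ s - t ∣ + d * x)) (∣-∣-swap t b) ⟩
    d * ∣ a - s ∣ + (d * ∣ s - t ∣ + d * ∣ b - t ∣)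
      ≤⟨ ℚ.+-mono-≤ (tail≤ ∣z∣≤r N m N≤m)
           (ℚ.+-mono-≤ (sum-lipschitz ∣z∣≤r ∣w∣≤r N) (tail≤ ∣w∣≤r N n N≤n)) ⟩
    ι 2 * p + (ι 2 * D * (1ℚ - p) + ι 2 * p)
      ≤⟨ ≤-from-diff (ι 2 * D * p)
           (*-nonNeg (*-nonNeg (0≤ι 2) (ℚ.0≤∣p∣ (z - w))) (^-nonNeg 0≤r N))
           (solve 2 (λ p D → con (ι 2) :* p :+ (con (ι 2) :* D :* (con 1ℚ :- p) :+ con (ι 2) :* p)
                               :+ con (ι 2) :* D :* p
                          := con (ι 4) :* p :+ con (ι 2) :* D) refl p D) ⟩
    ι 4 * p + ι 2 * D ∎
    where
    open ℚ.≤-Reasoning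
    d a b s t p D : ℚ
    d = 1ℚ - r
    a = atanhSum m z
    b = atanhSum n w
    s = atanhSum N z
    t = atanhSum N w
    p = r ^ N
    D = ∣ z - w ∣

0<1+ : ∀ {q} → 0ℚ ≤ q → 0ℚ < q + 1ℚ
0<1+ 0≤q = ℚ.+-mono-≤-< 0≤q 0<1

atanhArg≡ : ∀ {q} → 0ℚ ≤ q → atanhArg q ≡ 1ℚ - ι 2 * inv (q + 1ℚ)
atanhArg≡ {q} 0≤q = trans
  (solve 2 (λ q i → (q :- con 1ℚ) :* i := (q :+ con 1ℚ) :* i :- con (ι 2) :* i) refl q (inv (q + 1ℚ)))
  (cong (_- ι 2 * inv (q + 1ℚ)) (*-inv (0<1+ 0≤q)))

atanhArg-mono : ∀ {p q} → 0ℚ ≤ p → p ≤ q → atanhArg p ≤ atanhArg q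
atanhArg-mono {p} {q} 0≤p p≤q = subst₂ _≤_ (sym (atanhArg≡ 0≤p)) (sym (atanhArg≡ (ℚ.≤-trans 0≤p p≤q)))
  (ℚ.+-monoʳ-≤ 1ℚ (ℚ.neg-antimono-≤ (ℚ.*-monoˡ-≤-nonNeg (ι 2)
    (inv-anti (0<1+ 0≤p) (ℚ.+-monoˡ-≤ 1ℚ p≤q)))))

atanhArg-lipschitz : ∀ {p q} → 0ℚ ≤ p → 0ℚ ≤ q → ∣ atanhArg p - atanhArg q ∣ ≤ ι 2 * ∣ p - q ∣
atanhArg-lipschitz {p} {q} 0≤p 0≤q = begin
  ∣ atanhArg p - atanhArg q ∣
    ≡⟨ cong ∣_∣ (cong₂ _-_ (atanhArg≡ 0≤p) (atanhArg≡ 0≤q)) ⟩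
  ∣ (1ℚ - ι 2 * i) - (1ℚ - ι 2 * j) ∣
    ≡⟨ cong ∣_∣ (solve 2 (λ i j → (con 1ℚ :- con (ι 2) :* i) :- (con 1ℚ :- con (ι 2) :* j)
                               := con (ι 2) :* (j :- i)) refl i j) ⟩
  ∣ ι 2 * (j - i) ∣
    ≡⟨ ℚ.∣p*q∣≡∣p∣*∣q∣ (ι 2) (j - i) ⟩
  ι 2 * ∣ j - i ∣
    ≤⟨ ℚ.*-monoˡ-≤-nonNeg (ι 2) (inv-lipschitz 0<1 (1≤1+ 0≤q) (1≤1+ 0≤p)) ⟩
  ι 2 * (1ℚ * ∣ (q + 1ℚ) - (p + 1ℚ) ∣)
    ≡⟨ cong (ι 2 *_) (ℚ.*-identityˡ ∣ (q + 1ℚ) - (p + 1ℚ) ∣) ⟩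
  ι 2 * ∣ (q + 1ℚ) - (p + 1ℚ) ∣
    ≡⟨ cong (λ x → ι 2 * ∣ x ∣) (solve 2 (λ p q → (q :+ con 1ℚ) :- (p :+ con 1ℚ) := q :- p) refl p q) ⟩
  ι 2 * ∣ q - p ∣
    ≡⟨ cong (ι 2 *_) (∣-∣-swap q p) ⟩
  ι 2 * ∣ p - q ∣ ∎
  where
  open ℚ.≤-Reasoning
  i j : ℚ
  i = inv (p + 1ℚ)
  j = inv (q + 1ℚ)
  1≤1+ : ∀ {s} → 0ℚ ≤ s → 1ℚ ≤ s + 1ℚ
  1≤1+ {s} 0≤s = subst (_≤ s + 1ℚ) (ℚ.+-identityˡ 1ℚ) (ℚ.+-monoˡ-≤ 1ℚ 0≤s)

gap : ℚ → ℚ → ℚ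
gap δ B = ι 2 * δ * inv (B + 1ℚ)

∣atanhArg∣≤ : ∀ {δ B q} → 0ℚ < δ → δ ≤ 1ℚ → δ ≤ q → q ≤ B → ∣ atanhArg q ∣ ≤ 1ℚ - gap δ B
∣atanhArg∣≤ {δ} {B} {q} 0<δ δ≤1 δ≤q q≤B = subst (λ x → ∣ x ∣ ≤ 1ℚ - gap δ B) (sym (atanhArg≡ 0≤q))
  (∣∣-bound
    (ℚ.+-monoʳ-≤ 1ℚ (ℚ.neg-antimono-≤ (*-mono 0≤2δ
      (ℚ.*-monoˡ-≤-nonNeg (ι 2) δ≤1) 0≤k k≤i)))
    (≤-from-diff (ι 2 * q * i - gap δ B)
      (0≤diff (*-mono 0≤2δ (ℚ.*-monoˡ-≤-nonNeg (ι 2) δ≤q) 0≤k k≤i))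
      (trans
        (solve 3 (λ q i g → :- (con 1ℚ :- con (ι 2) :* i) :+ (con (ι 2) :* q :* i :- g)
           := (con (ι 2) :* ((q :+ con 1ℚ) :* i) :- con 1ℚ) :- g) refl q i (gap δ B))
        (cong (λ x → (ι 2 * x - 1ℚ) - gap δ B) (*-inv (0<1+ 0≤q))))))
  where
  0≤q : 0ℚ ≤ q
  0≤q = ℚ.≤-trans (ℚ.<⇒≤ 0<δ) δ≤q
  i : ℚ
  i = inv (q + 1ℚ)
  0≤2δ : 0ℚ ≤ ι 2 * δ
  0≤2δ = *-nonNeg (0≤ι 2) (ℚ.<⇒≤ 0<δ)
  0≤k : 0ℚ ≤ inv (B + 1ℚ)
  0≤k = 0≤inv (0<1+ (ℚ.≤-trans 0≤q q≤B))
  k≤i : inv (B + 1ℚ) ≤ i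
  k≤i = inv-anti (0<1+ 0≤q) (ℚ.+-monoˡ-≤ 1ℚ q≤B)

inv-cancel : ∀ {d p q} → 0ℚ < d → d * p ≤ q → p ≤ inv d * q
inv-cancel {d} {p} {q} 0<d h = subst (_≤ inv d * q)
  (trans (sym (ℚ.*-assoc (inv d) d p))
    (trans (cong (_* p) (trans (ℚ.*-comm (inv d) d) (*-inv 0<d))) (ℚ.*-identityˡ p)))
  (ℚ.*-monoˡ-≤-nonNeg (inv d) {{ℚ.nonNegative (0≤inv 0<d)}} h)

cauchy-atanhSum : ∀ {r} (z : ℕ → ℚ) → r < 1ℚ → IsCauchy z →
  ∃[ M ] (∀ n → M ℕ.≤ n → ∣ z n ∣ ≤ r) → IsCauchy (λ n → atanhSum n (z n))
cauchy-atanhSum {r} z r<1 z-cauchy (M , ∣z∣≤r) =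
  cauchy-scaled (λ n → atanhSum n (z n)) (inv (1ℚ - r) * ι 6) (*-pos (0<inv 0<1-r) (0<ι 5)) step
  where
  0≤r : 0ℚ ≤ r
  0≤r = ℚ.≤-trans (ℚ.0≤∣p∣ (z M)) (∣z∣≤r M ℕ.≤-refl)
  0<1-r : 0ℚ < 1ℚ - r
  0<1-r = subst (_< 1ℚ - r) (ℚ.+-inverseʳ r) (ℚ.+-monoˡ-< (- r) r<1)
  step : ∀ ε → 0ℚ < ε → ∃[ N ] (∀ m n → N ℕ.≤ m → N ℕ.≤ n →
    ∣ atanhSum m (z m) - atanhSum n (z n) ∣ ≤ inv (1ℚ - r) * ι 6 * ε)
  step ε 0<ε = combine (z-cauchy ε 0<ε) (geometric-small 0≤r r<1 ε 0<ε)
    where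
    combine : ∃[ N ] (∀ m n → N ℕ.≤ m → N ℕ.≤ n → ∣ z m - z n ∣ ≤ ε) → ∃[ N ] r ^ N ≤ ε →
      ∃[ N ] (∀ m n → N ℕ.≤ m → N ℕ.≤ n →
        ∣ atanhSum m (z m) - atanhSum n (z n) ∣ ≤ inv (1ℚ - r) * ι 6 * ε)
    combine (N₁ , close) (N₂ , small) = M ℕ.⊔ (N₁ ℕ.⊔ N₂) , λ m n hm hn →
      bound m n (m≤o₁ M (N₁ ℕ.⊔ N₂) hm) (m≤o₁ M (N₁ ℕ.⊔ N₂) hn)
                (m≤o₂ M (N₁ ℕ.⊔ N₂) hm) (m≤o₂ M (N₁ ℕ.⊔ N₂) hn)
      where
      bound : ∀ m n → M ℕ.≤ m → M ℕ.≤ n → N₁ ℕ.⊔ N₂ ℕ.≤ m → N₁ ℕ.⊔ N₂ ℕ.≤ n →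
        ∣ atanhSum m (z m) - atanhSum n (z n) ∣ ≤ inv (1ℚ - r) * ι 6 * ε
      bound m n M≤m M≤n hm hn = begin
        ∣ atanhSum m (z m) - atanhSum n (z n) ∣
          ≤⟨ inv-cancel 0<1-r (sum-close 0≤r r<1 (∣z∣≤r m M≤m) (∣z∣≤r n M≤n) N₂ m n
               (m≤o₂ N₁ N₂ hm) (m≤o₂ N₁ N₂ hn)) ⟩
        inv (1ℚ - r) * (ι 4 * r ^ N₂ + ι 2 * ∣ z m - z n ∣)
          ≤⟨ ℚ.*-monoˡ-≤-nonNeg (inv (1ℚ - r)) {{ℚ.nonNegative (0≤inv 0<1-r)}}
               (ℚ.+-mono-≤ (ℚ.*-monoˡ-≤-nonNeg (ι 4) small)
                 (ℚ.*-monoˡ-≤-nonNeg (ι 2) (close m n (m≤o₁ N₁ N₂ hm) (m≤o₁ N₁ N₂ hn)))) ⟩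
        inv (1ℚ - r) * (ι 4 * ε + ι 2 * ε)
          ≡⟨ solve 2 (λ i e → i :* (con (ι 4) :* e :+ con (ι 2) :* e) := i :* con (ι 6) :* e)
                     refl (inv (1ℚ - r)) ε ⟩
        inv (1ℚ - r) * ι 6 * ε ∎
        where open ℚ.≤-Reasoning

cauchy-atanhArg : ∀ {δ} x → 0ℚ < δ → ∃[ M ] (∀ n → M ℕ.≤ n → δ ≤ seq x n) →
                  IsCauchy (atanhArg ∘ seq x)
cauchy-atanhArg {δ} x 0<δ (M , δ≤x) = cauchy-scaled (atanhArg ∘ seq x) (ι 2) (0<ι 1) step
  where
  step : ∀ ε → 0ℚ < ε → ∃[ N ] (∀ m n → N ℕ.≤ m → N ℕ.≤ n →
    ∣ atanhArg (seq x m) - atanhArg (seq x n) ∣ ≤ ι 2 * ε)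
  step ε 0<ε with cauchy x ε 0<ε
  ... | N , close = M ℕ.⊔ N , λ m n hm hn → ℚ.≤-trans
    (atanhArg-lipschitz (0≤x m (m≤o₁ M N hm)) (0≤x n (m≤o₁ M N hn)))
    (ℚ.*-monoˡ-≤-nonNeg (ι 2) (close m n (m≤o₂ M N hm) (m≤o₂ M N hn)))
    where
    0≤x : ∀ n → M ℕ.≤ n → 0ℚ ≤ seq x n
    0≤x n M≤n = ℚ.≤-trans (ℚ.<⇒≤ 0<δ) (δ≤x n M≤n)

∣atanhArg∣-bounded : ∀ x → 0ℝ <ℝ x →
  ∃[ r ] r < 1ℚ × ∃[ M ] (∀ n → M ℕ.≤ n → ∣ atanhArg (seq x n) ∣ ≤ r)
∣atanhArg∣-bounded x 0<x = combine (eventually-positive x 0<x) (bounded x)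
  where
  combine : (∃[ δ ] 0ℚ < δ × ∃[ M ] (∀ n → M ℕ.≤ n → δ ≤ seq x n)) →
            (∃[ B ] 0ℚ < B × ∃[ M ] (∀ n → M ℕ.≤ n → ∣ seq x n ∣ ≤ B)) →
            ∃[ r ] r < 1ℚ × ∃[ M ] (∀ n → M ℕ.≤ n → ∣ atanhArg (seq x n) ∣ ≤ r)
  combine (δ , 0<δ , M₁ , δ≤x) (B , 0<B , M₂ , x≤B) = clamped (ℚ.≤-total δ 1ℚ)
    where
    conclude : ∀ ε → 0ℚ < ε → ε ≤ 1ℚ → ε ≤ δ →
      ∃[ r ] r < 1ℚ × ∃[ M ] (∀ n → M ℕ.≤ n → ∣ atanhArg (seq x n) ∣ ≤ r)
    conclude ε 0<ε ε≤1 ε≤δ = 1ℚ - gap ε B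
      , <-from-diff (gap ε B) (*-pos (*-pos (0<ι 1) 0<ε) (0<inv (0<1+ (ℚ.<⇒≤ 0<B))))
          (solve 1 (λ g → con 1ℚ :- g :+ g := con 1ℚ) refl (gap ε B))
      , M₁ ℕ.⊔ M₂ , λ n hn → ∣atanhArg∣≤ 0<ε ε≤1
          (ℚ.≤-trans ε≤δ (δ≤x n (m≤o₁ M₁ M₂ hn)))
          (ℚ.≤-trans (p≤∣p∣ (seq x n)) (x≤B n (m≤o₂ M₁ M₂ hn)))
    clamped : δ ≤ 1ℚ ⊎ 1ℚ ≤ δ →
      ∃[ r ] r < 1ℚ × ∃[ M ] (∀ n → M ℕ.≤ n → ∣ atanhArg (seq x n) ∣ ≤ r)
    clamped (inj₁ δ≤1) = conclude δ 0<δ δ≤1 ℚ.≤-refl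
    clamped (inj₂ 1≤δ) = conclude 1ℚ 0<1 ℚ.≤-refl 1≤δ

ln : (x : ℝ) → 0ℝ <ℝ x → ℝ
ln x 0<x = mkℝ (λ n → atanhSum n (atanhArg (seq x n)))
               (cauchy-ln (eventually-positive x 0<x) (∣atanhArg∣-bounded x 0<x))
  where
  cauchy-ln : (∃[ δ ] 0ℚ < δ × ∃[ M ] (∀ n → M ℕ.≤ n → δ ≤ seq x n)) →
              (∃[ r ] r < 1ℚ × ∃[ M ] (∀ n → M ℕ.≤ n → ∣ atanhArg (seq x n) ∣ ≤ r)) →
              IsCauchy (λ n → atanhSum n (atanhArg (seq x n)))
  cauchy-ln (δ , 0<δ , δ≤x) (r , r<1 , ∣z∣≤r) =
    cauchy-atanhSum (atanhArg ∘ seq x) r<1 (cauchy-atanhArg x 0<δ δ≤x) ∣z∣≤r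

atanhTerm-nonNeg : ∀ k {z} → 0ℚ ≤ z → 0ℚ ≤ atanhTerm k z
atanhTerm-nonNeg k 0≤z = *-nonNeg (*-nonNeg (0≤ι 2) (^-nonNeg 0≤z (suc (2 ℕ.* k))))
                                  (0≤inv (0<ι (2 ℕ.* k)))

atanhSum-mono : ∀ N {z w} → 0ℚ ≤ z → z ≤ w → atanhSum N z ≤ atanhSum N w
atanhSum-mono zero    0≤z z≤w = ℚ.≤-refl
atanhSum-mono (suc N) 0≤z z≤w = ℚ.+-mono-≤ (atanhSum-mono N 0≤z z≤w)
  (*-monoʳ (0≤inv (0<ι (2 ℕ.* N))) (ℚ.*-monoˡ-≤-nonNeg (ι 2) (^-mono 0≤z z≤w (suc (2 ℕ.* N)))))

atanhSum-extend : ∀ {z} → 0ℚ ≤ z → ∀ M j → atanhSum M z ≤ atanhSum (j ℕ.+ M) z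
atanhSum-extend 0≤z M zero    = ℚ.≤-refl
atanhSum-extend 0≤z M (suc j) = ≤-from-diff-trans (atanhSum-extend 0≤z M j) (atanhTerm-nonNeg (j ℕ.+ M) 0≤z)
  where
  ≤-from-diff-trans : ∀ {p q s} → p ≤ q → 0ℚ ≤ s → p ≤ q + s
  ≤-from-diff-trans p≤q 0≤s = ℚ.≤-trans p≤q (≤-from-diff _ 0≤s refl)

ln-lower : ∀ x (0<x : 0ℝ <ℝ x) p M n → 1ℚ ≤ p → p ≤ seq x n → M ℕ.≤ n →
           atanhSum M (atanhArg p) ≤ seq (ln x 0<x) n
ln-lower x 0<x p M n 1≤p p≤x M≤n = ℚ.≤-trans
  (atanhSum-mono M 0≤z (atanhArg-mono (ℚ.≤-trans (ℚ.<⇒≤ 0<1) 1≤p) p≤x))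
  (subst (λ k → atanhSum M (atanhArg (seq x n)) ≤ atanhSum k (atanhArg (seq x n))) (ℕ.m∸n+n≡m M≤n)
    (atanhSum-extend (ℚ.≤-trans 0≤z (atanhArg-mono (ℚ.≤-trans (ℚ.<⇒≤ 0<1) 1≤p) p≤x)) M (n ℕ.∸ M)))
  where
  0≤z : 0ℚ ≤ atanhArg p
  0≤z = *-nonNeg (0≤diff 1≤p) (0≤inv (0<1+ (ℚ.≤-trans (ℚ.<⇒≤ 0<1) 1≤p)))

<ℝ-trans : ∀ {x y z} → x <ℝ y → y <ℝ z → x <ℝ z
<ℝ-trans {x} {y} {z} (δ , 0<δ , M , h) (ε , 0<ε , N , k) = δ , 0<δ , M ℕ.⊔ N , λ n hn →
  ℚ.≤-trans (h n (m≤o₁ M N hn)) (ℚ.≤-trans (≤-from-diff ε (ℚ.<⇒≤ 0<ε) refl) (k n (m≤o₂ M N hn)))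

0<1ℝ : 0ℝ <ℝ 1ℝ
0<1ℝ = 1ℚ , 0<1 , 0 , λ _ _ → ℚ.≤-refl

ln-pos : ∀ x (0<x : 0ℝ <ℝ x) → 1ℝ <ℝ x → 0ℝ <ℝ ln x 0<x
ln-pos x 0<x (δ , 0<δ , N , h) = atanhSum 1 w , 0<sum , N ℕ.⊔ 1 , λ n hn →
  subst (_≤ seq (ln x 0<x) n) (sym (ℚ.+-identityˡ (atanhSum 1 w)))
    (ln-lower x 0<x (1ℚ + δ) 1 n (≤-from-diff δ (ℚ.<⇒≤ 0<δ) refl) (h n (m≤o₁ N 1 hn)) (m≤o₂ N 1 hn))
  where
  w : ℚ
  w = atanhArg (1ℚ + δ)
  0<w : 0ℚ < w
  0<w = *-pos (subst (0ℚ <_) (solve 1 (λ d → d := con 1ℚ :+ d :- con 1ℚ) refl δ) 0<δ)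
              (0<inv (ℚ.+-mono-< (ℚ.+-mono-< 0<1 0<δ) 0<1))
  0<sum : 0ℚ < atanhSum 1 w
  0<sum = subst (0ℚ <_) (sym (ℚ.+-identityˡ (atanhTerm 0 w)))
    (*-pos (*-pos (0<ι 1) (*-pos 0<w 0<1)) (0<inv (0<ι 0)))

fromℕ-pos : ∀ {n} → 1 ℕ.≤ n → 0ℝ <ℝ fromℕ n
fromℕ-pos {n} 1≤n = 1ℚ , 0<1 , 0 , λ _ _ → ι-mono {1} {n} 1≤n

1<ln3 : ι 1 + + 1 / 12 ≤ atanhSum 2 (atanhArg (ι 3))
1<ln3 = ℚ.≤-reflexive refl

1<ln-fromℕ : ∀ {n} → 3 ℕ.≤ n → (0<n : 0ℝ <ℝ fromℕ n) → 1ℝ <ℝ ln (fromℕ n) 0<n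
1<ln-fromℕ {n} 3≤n 0<n = + 1 / 12 , ℚ.positive⁻¹ (+ 1 / 12) , 2 , bound
  where
  bound : ∀ m → 2 ℕ.≤ m → ι 1 + + 1 / 12 ≤ seq (ln (fromℕ n) 0<n) m
  bound m 2≤m = ℚ.≤-trans 1<ln3 (ln-lower (fromℕ n) 0<n (ι 3) 2 m
    (ι-mono {1} {3} (ℕ.s≤s ℕ.z≤n)) (ι-mono {3} {n} 3≤n) 2≤m)

-- ln n and ln ln n for n ≥ 3, where both are positive.

lnℕ : ∀ n → 3 ℕ.≤ n → ℝ
lnℕ n 3≤n = ln (fromℕ n) (fromℕ-pos (ℕ.≤-trans (ℕ.s≤s ℕ.z≤n) 3≤n))

1<lnℕ : ∀ n (3≤n : 3 ℕ.≤ n) → 1ℝ <ℝ lnℕ n 3≤n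
1<lnℕ n 3≤n = 1<ln-fromℕ 3≤n (fromℕ-pos (ℕ.≤-trans (ℕ.s≤s ℕ.z≤n) 3≤n))

0<lnℕ : ∀ n (3≤n : 3 ℕ.≤ n) → 0ℝ <ℝ lnℕ n 3≤n
0<lnℕ n 3≤n = <ℝ-trans {0ℝ} {1ℝ} {lnℕ n 3≤n} 0<1ℝ (1<lnℕ n 3≤n)

lnlnℕ : ∀ n → 3 ℕ.≤ n → ℝ
lnlnℕ n 3≤n = ln (lnℕ n 3≤n) (0<lnℕ n 3≤n)

0<lnlnℕ : ∀ n (3≤n : 3 ℕ.≤ n) → 0ℝ <ℝ lnlnℕ n 3≤n
0<lnlnℕ n 3≤n = ln-pos (lnℕ n 3≤n) (0<lnℕ n 3≤n) (1<lnℕ n 3≤n)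

{-# OPTIONS --safe #-}

-- Suppose a (3,3)-tournament on 0, …, n-1 has no tight path on s vertices. For u < v consider
-- tight paths v, u, r₁, …, r_ℓ whose rᵢ are below v and, with at most one exception, below u, and
-- label the pair by the largest such ℓ < s; label it a second time for the reversed order. By
-- Ramsey's theorem with O(s²) colours some T vertices have the same two labels on all pairs, unless
-- n < s^O(s²). Prepending w to the path of (u , v) shows that the edges wvu and uvw are missing for
-- u < v < w in this set, so three of the remaining four orderings are edges: either both vwu and wuv,
-- or both uwv and vuw. If T is the Ramsey number for triples, one alternative holds on 7 vertices
-- a < u₁ < u₂ < c < x < w < y; then y x w uᵢ c a prolongs the path of (a , c) to one of (x , y) for
-- some i, so the label increases (in the reversed order for the second alternative).
--
-- For the logarithms: each doubling of q changes every partial sum of the series of ln q by at most 2,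
-- and every late enough one by at least 1/4.

module Submission where

open import Defs
open import Data.Bool.Base using (Bool; true; false; T; _∧_)
open import Data.Bool.Properties using (T?; T-∧)
open import Data.Fin.Base as Fin using (Fin; zero; suc; toℕ; fromℕ<; inject≤; combine)
import Data.Fin.Properties as Fin
open import Data.Integer.Base using (+_)
open import Data.List.Base using (List; []; _∷_; length; lookup; filter; filterᵇ; allFin; map)
import Data.List.Properties as List
open import Data.List.Membership.Propositional.Properties using (∈-lookup)
open import Data.List.Relation.Binary.Sublist.Propositional
  using (_⊆_; []; _∷_; _∷ʳ_; ⊆-trans; ⊆-refl; minimum)
import Data.List.Relation.Binary.Sublist.Propositional.Properties as Sublist
open import Data.List.Relation.Unary.All as All using (All; []; _∷_)
import Data.List.Relation.Unary.All.Properties as All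
open import Data.List.Relation.Unary.AllPairs as AllPairs using (AllPairs; []; _∷_)
import Data.List.Relation.Unary.AllPairs.Properties as AllPairs
open import Data.List.Relation.Unary.Unique.Propositional using (Unique)
open import Data.Nat.Base as ℕ using (ℕ; zero; suc)
open import Data.Nat.ListAction using (sum)
import Data.Nat.Properties as ℕ
open import Data.Nat.Tactic.RingSolver using (solve-∀)
open import Data.Product.Base using (∃-syntax; _×_; _,_; proj₁; proj₂)
open import Data.Rational.Base as ℚ using (ℚ)
import Data.Rational.Properties as ℚ
open import Data.Rational.Solver using (module +-*-Solver)
open import Data.Sum.Base using (_⊎_; inj₁; inj₂)
open import Data.Unit.Base using (⊤; tt)
open import Function.Base using (_∘_; flip)
open import Function.Bundles using (Equivalence)
open import Level using (0ℓ)
open import Relation.Binary.Construct.Flip.EqAndOrd using ()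
  renaming (isStrictPartialOrder to flip-isStrictPartialOrder)
open import Relation.Binary.Core using (Rel)
open import Relation.Binary.Definitions using () renaming (Decidable to Decidable₂)
open import Relation.Binary.PropositionalEquality
open import Relation.Binary.Structures using (IsStrictPartialOrder)
open import Relation.Nullary using (¬_; Dec; yes; no; contradiction)
open import Relation.Nullary.Decidable
  using (⌊_⌋; map′; _×-dec_; _⊎-dec_; ¬?; decidable-stable; toWitness; from-yes)
open import Relation.Unary using (Decidable)

-- Partial sums of the logarithm series at powers of two

module Logarithm where

  open import Data.Rational.Base using (0ℚ; 1ℚ; _/_; _+_; _*_; _-_; _≤_; _<_; ∣_∣)
  open import Algebra.Definitions.RawSemiring ℚ.+-*-rawSemiring using (_^_)
  open +-*-Solver using (solve; _:+_; _:*_; _:-_; _:=_; con)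

  ½ ¼ : ℚ
  ½ = + 1 / 2
  ¼ = + 1 / 4

  0<½ : 0ℚ < ½
  0<½ = from-yes (0ℚ ℚ.<? ½)

  0<¼ : 0ℚ < ¼
  0<¼ = from-yes (0ℚ ℚ.<? ¼)

  *-monoˡ : ∀ {p q r} → 0ℚ ≤ r → p ≤ q → r * p ≤ r * q
  *-monoˡ {r = r} 0≤r = ℚ.*-monoˡ-≤-nonNeg r {{ℚ.nonNegative 0≤r}}

  inv-cancel≥ : ∀ {d p q} → 0ℚ < d → d * p ≤ d * q → p ≤ q
  inv-cancel≥ {d} 0<d = ℚ.*-cancelˡ-≤-pos d {{ℚ.positive 0<d}}

  -- The series of ln `x` and ln `2x` are evaluated at `w` and `z`. The limit of the difference is
  -- ln 2; the crude bounds 2 and 1/4 suffice for orders of magnitude.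
  module Doubling {x} (1≤x : 1ℚ ≤ x) where

    0≤x : 0ℚ ≤ x
    0≤x = ℚ.≤-trans (ℚ.<⇒≤ 0<1) 1≤x
    0≤2x : 0ℚ ≤ ι 2 * x
    0≤2x = *-nonNeg (0≤ι 2) 0≤x
    i j z w : ℚ
    i = inv (x + 1ℚ)
    j = inv (ι 2 * x + 1ℚ)
    z = atanhArg (ι 2 * x)
    w = atanhArg x
    0<x+1 : 0ℚ < x + 1ℚ
    0<x+1 = 0<1+ 0≤x
    0<2x+1 : 0ℚ < ι 2 * x + 1ℚ
    0<2x+1 = 0<1+ 0≤2x
    0≤i : 0ℚ ≤ i
    0≤i = 0≤inv 0<x+1
    0≤j : 0ℚ ≤ j
    0≤j = 0≤inv 0<2x+1
    i-def : (x + 1ℚ) * i ≡ 1ℚ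
    i-def = *-inv 0<x+1
    j-def : (ι 2 * x + 1ℚ) * j ≡ 1ℚ
    j-def = *-inv 0<2x+1

    0≤w : 0ℚ ≤ w
    0≤w = *-nonNeg (0≤diff 1≤x) 0≤i

    w≤z : w ≤ z
    w≤z = atanhArg-mono 0≤x (≤-from-diff x 0≤x (solve 1 (λ x → x :+ x := con (ι 2) :* x) refl x))

    0≤z : 0ℚ ≤ z
    0≤z = ℚ.≤-trans 0≤w w≤z

    0≤z-w : 0ℚ ≤ z - w
    0≤z-w = 0≤diff w≤z

    1-z≡ : 1ℚ - z ≡ ι 2 * j
    1-z≡ = trans (cong (λ t → 1ℚ - t) (atanhArg≡ 0≤2x))
      (solve 1 (λ j → con 1ℚ :- (con 1ℚ :- con (ι 2) :* j) := con (ι 2) :* j) refl j)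

    z-w≡ : z - w ≡ ι 2 * x * (i * j)
    z-w≡ = trans (cong₂ _-_ (atanhArg≡ 0≤2x) (atanhArg≡ 0≤x)) (trans
      (solve 2 (λ i j → (con 1ℚ :- con (ι 2) :* j) :- (con 1ℚ :- con (ι 2) :* i) := con (ι 2) :* (i :- j)) refl i j)
      (trans (cong (ι 2 *_) (inv-diff 0<x+1 0<2x+1))
        (solve 2 (λ x ij → con (ι 2) :* ((con (ι 2) :* x :+ con 1ℚ :- (x :+ con 1ℚ)) :* ij) := con (ι 2) :* x :* ij)
          refl x (i * j))))

    0<j : 0ℚ < j
    0<j = 0<inv 0<2x+1

    z<1 : z < 1ℚ
    z<1 = <-from-diff (ι 2 * j) (*-pos (0<ι 1) 0<j)
      (trans (cong (λ t → z + t) (sym 1-z≡)) (solve 1 (λ z → z :+ (con 1ℚ :- z) := con 1ℚ) refl z))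

    ∣z∣≤z : ∣ z ∣ ≤ z
    ∣z∣≤z = ℚ.≤-reflexive (ℚ.0≤p⇒∣p∣≡p 0≤z)

    ∣w∣≤z : ∣ w ∣ ≤ z
    ∣w∣≤z = ℚ.≤-trans (ℚ.≤-reflexive (ℚ.0≤p⇒∣p∣≡p 0≤w)) w≤z

    xi≤1 : x * i ≤ 1ℚ
    xi≤1 = ≤-from-diff i 0≤i (trans (solve 2 (λ x i → x :* i :+ i := (x :+ con 1ℚ) :* i) refl x i) i-def)

    -- The Lipschitz bound with radius `z` itself: its factor `1 - z = 2j` cancels the `j` in
    -- `z - w = 2xij`, which leaves `2xi ≤ 2` uniformly in `N`.
    doubling-≤ : ∀ N → atanhSum N z ≤ atanhSum N w + ι 2
    doubling-≤ N = ∣-∣⇒≤ (inv-cancel≥ (*-pos (0<ι 1) 0<j) (begin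
      ι 2 * j * ∣ atanhSum N z - atanhSum N w ∣
        ≡⟨ cong (_* ∣ atanhSum N z - atanhSum N w ∣) (sym 1-z≡) ⟩
      (1ℚ - z) * ∣ atanhSum N z - atanhSum N w ∣
        ≤⟨ sum-lipschitz 0≤z z<1 ∣z∣≤z ∣w∣≤z N ⟩
      ι 2 * ∣ z - w ∣ * (1ℚ - z ^ N)
        ≤⟨ *-monoˡ (*-nonNeg (0≤ι 2) (ℚ.0≤∣p∣ (z - w)))
            (≤-from-diff (z ^ N) (^-nonNeg 0≤z N) (solve 1 (λ p → con 1ℚ :- p :+ p := con 1ℚ) refl (z ^ N))) ⟩
      ι 2 * ∣ z - w ∣ * 1ℚ
        ≡⟨ cong (λ t → ι 2 * t * 1ℚ) (trans (ℚ.0≤p⇒∣p∣≡p 0≤z-w) z-w≡) ⟩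
      ι 2 * (ι 2 * x * (i * j)) * 1ℚ
        ≡⟨ solve 3 (λ x i j → con (ι 2) :* (con (ι 2) :* x :* (i :* j)) :* con 1ℚ
             := con (ι 2) :* j :* con (ι 2) :* (x :* i)) refl x i j ⟩
      ι 2 * j * ι 2 * (x * i)
        ≤⟨ *-monoˡ (*-nonNeg (*-nonNeg (0≤ι 2) 0≤j) (0≤ι 2)) xi≤1 ⟩
      ι 2 * j * ι 2 * 1ℚ
        ≡⟨ ℚ.*-identityʳ (ι 2 * j * ι 2) ⟩
      ι 2 * j * ι 2 ∎))
      where open ℚ.≤-Reasoning

    -- A mean value estimate: on the interval from `w` to `z` the derivative of the power is
    -- smallest at `w`.
    ^-growth : ∀ k → ι (suc k) * w ^ k * (z - w) ≤ z ^ suc k - w ^ suc k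
    ^-growth zero = ℚ.≤-reflexive
      (solve 2 (λ z w → con 1ℚ :* con 1ℚ :* (z :- w) := z :* con 1ℚ :- w :* con 1ℚ) refl z w)
    ^-growth (suc k) = begin
      ι (suc (suc k)) * (w * p) * (z - w)
        ≡⟨ cong (λ n → n * (w * p) * (z - w)) (ι-suc (suc k)) ⟩
      (ι (suc k) + 1ℚ) * (w * p) * (z - w)
        ≡⟨ solve 4 (λ n w p d → (n :+ con 1ℚ) :* (w :* p) :* d := w :* (n :* p :* d) :+ w :* p :* d)
             refl (ι (suc k)) w p (z - w) ⟩
      w * (ι (suc k) * p * (z - w)) + w * p * (z - w)
        ≤⟨ ℚ.+-monoˡ-≤ (w * p * (z - w))
             (*-mono 0≤w w≤z (*-nonNeg (*-nonNeg (0≤ι (suc k)) (^-nonNeg 0≤w k)) 0≤z-w) (^-growth k)) ⟩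
      z * (z ^ suc k - w * p) + w * p * (z - w)
        ≡⟨ solve 4 (λ z w p q → z :* (q :- w :* p) :+ w :* p :* (z :- w) := z :* q :- w :* (w :* p))
             refl z w p (z ^ suc k) ⟩
      z * z ^ suc k - w * (w * p) ∎
      where
      open ℚ.≤-Reasoning
      p : ℚ
      p = w ^ k

    term-growth : ∀ k → ι 2 * (z - w) * w ^ (2 ℕ.* k) ≤ atanhTerm k z - atanhTerm k w
    term-growth k = begin
      ι 2 * (z - w) * p
        ≡⟨ sym (ℚ.*-identityʳ (ι 2 * (z - w) * p)) ⟩
      ι 2 * (z - w) * p * 1ℚ
        ≡⟨ cong (ι 2 * (z - w) * p *_) (sym (*-inv (0<ι (2 ℕ.* k)))) ⟩
      ι 2 * (z - w) * p * (m * r)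
        ≡⟨ solve 4 (λ d p m r → con (ι 2) :* d :* p :* (m :* r) := con (ι 2) :* (m :* p :* d) :* r)
             refl (z - w) p m r ⟩
      ι 2 * (m * p * (z - w)) * r
        ≤⟨ *-monoʳ (0≤inv (0<ι (2 ℕ.* k))) (*-monoˡ (0≤ι 2) (^-growth (2 ℕ.* k))) ⟩
      ι 2 * (z ^ suc (2 ℕ.* k) - w ^ suc (2 ℕ.* k)) * r
        ≡⟨ solve 3 (λ a b r → con (ι 2) :* (a :- b) :* r := con (ι 2) :* a :* r :- con (ι 2) :* b :* r)
             refl (z ^ suc (2 ℕ.* k)) (w ^ suc (2 ℕ.* k)) r ⟩
      atanhTerm k z - atanhTerm k w ∎
      where
      open ℚ.≤-Reasoning
      p m r : ℚ
      p = w ^ (2 ℕ.* k)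
      m = ι (suc (2 ℕ.* k))
      r = inv m

    0≤1-ww : 0ℚ ≤ 1ℚ - w * w
    0≤1-ww = 0≤diff (*-mono 0≤w w≤1 0≤w w≤1)
      where
      w≤1 : w ≤ 1ℚ
      w≤1 = ℚ.≤-trans w≤z (ℚ.<⇒≤ z<1)

    -- Summing `term-growth` gives a geometric series with ratio `w * w`; multiplying by
    -- `1ℚ - w * w` avoids the division.
    sum-growth : ∀ N → ι 2 * (z - w) * (1ℚ - w ^ (2 ℕ.* N)) ≤ (1ℚ - w * w) * (atanhSum N z - atanhSum N w)
    sum-growth zero = ℚ.≤-reflexive (solve 2 (λ d w → con (ι 2) :* d :* (con 1ℚ :- con 1ℚ)
      := (con 1ℚ :- w :* w) :* (con 0ℚ :- con 0ℚ)) refl (z - w) w)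
    sum-growth (suc N) = begin
      ι 2 * (z - w) * (1ℚ - w ^ (2 ℕ.* suc N))
        ≡⟨ cong (λ e → ι 2 * (z - w) * (1ℚ - w ^ e)) (ℕ.*-suc 2 N) ⟩
      ι 2 * (z - w) * (1ℚ - w * (w * p))
        ≡⟨ solve 3 (λ d w p → con (ι 2) :* d :* (con 1ℚ :- w :* (w :* p))
             := con (ι 2) :* d :* (con 1ℚ :- p) :+ (con 1ℚ :- w :* w) :* (con (ι 2) :* d :* p)) refl (z - w) w p ⟩
      ι 2 * (z - w) * (1ℚ - p) + (1ℚ - w * w) * (ι 2 * (z - w) * p)
        ≤⟨ ℚ.+-mono-≤ (sum-growth N) (*-monoˡ 0≤1-ww (term-growth N)) ⟩
      (1ℚ - w * w) * (s - t) + (1ℚ - w * w) * (a - b)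
        ≡⟨ solve 5 (λ c s t a b → c :* (s :- t) :+ c :* (a :- b) := c :* (s :+ a :- (t :+ b)))
             refl (1ℚ - w * w) s t a b ⟩
      (1ℚ - w * w) * (s + a - (t + b)) ∎
      where
      open ℚ.≤-Reasoning
      p s t a b : ℚ
      p = w ^ (2 ℕ.* N)
      s = atanhSum N z
      t = atanhSum N w
      a = atanhTerm N z
      b = atanhTerm N w

    1-ww≡ : 1ℚ - w * w ≡ ι 4 * x * (i * i)
    1-ww≡ = begin
      1ℚ - w * w
        ≡⟨ cong (λ t → 1ℚ - t * t) (atanhArg≡ 0≤x) ⟩
      1ℚ - (1ℚ - ι 2 * i) * (1ℚ - ι 2 * i)
        ≡⟨ solve 1 (λ i → con 1ℚ :- (con 1ℚ :- con (ι 2) :* i) :* (con 1ℚ :- con (ι 2) :* i)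
             := con (ι 4) :* (con 1ℚ :* i :- i :* i)) refl i ⟩
      ι 4 * (1ℚ * i - i * i)
        ≡⟨ cong (λ t → ι 4 * (t * i - i * i)) (sym i-def) ⟩
      ι 4 * ((x + 1ℚ) * i * i - i * i)
        ≡⟨ solve 2 (λ x i → con (ι 4) :* ((x :+ con 1ℚ) :* i :* i :- i :* i) := con (ι 4) :* x :* (i :* i)) refl x i ⟩
      ι 4 * x * (i * i) ∎
      where open ≡-Reasoning

    0<i : 0ℚ < i
    0<i = 0<inv 0<x+1

    -- Equivalent to `2x + 1 ≤ 2(x + 1)`.
    i≤2j : i ≤ ι 2 * j
    i≤2j = begin
      i ≡⟨ sym (ℚ.*-identityʳ i) ⟩
      i * 1ℚ ≡⟨ cong (i *_) (sym j-def) ⟩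
      i * ((ι 2 * x + 1ℚ) * j)
        ≤⟨ ≤-from-diff (i * j) (*-nonNeg 0≤i 0≤j)
             (solve 3 (λ x i j → i :* ((con (ι 2) :* x :+ con 1ℚ) :* j) :+ i :* j
               := con (ι 2) :* j :* ((x :+ con 1ℚ) :* i)) refl x i j) ⟩
      ι 2 * j * ((x + 1ℚ) * i) ≡⟨ cong (ι 2 * j *_) i-def ⟩
      ι 2 * j * 1ℚ ≡⟨ ℚ.*-identityʳ (ι 2 * j) ⟩
      ι 2 * j ∎
      where open ℚ.≤-Reasoning

    w<1 : w < 1ℚ
    w<1 = ℚ.≤-<-trans w≤z z<1

    -- Once the geometric remainder is at most 1/2, `sum-growth` divided by `1 - w² = 4xi²` bounds
    -- the difference below by `2xij / 4xi² = j / 2i`, which is at least 1/4.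
    doubling-≥-after : ∀ N → w ^ N ≤ ½ → atanhSum N w + ¼ ≤ atanhSum N z
    doubling-≥-after N small = ≤-from-diff (d - ¼)
      (0≤diff (inv-cancel≥ 0<c bound))
      (solve 3 (λ s t q → t :+ q :+ (s :- t :- q) := s) refl (atanhSum N z) (atanhSum N w) ¼)
      where
      open ℚ.≤-Reasoning
      d c p : ℚ
      d = atanhSum N z - atanhSum N w
      c = ι 4 * x * (i * i)
      p = w ^ (2 ℕ.* N)
      0<c : 0ℚ < c
      0<c = *-pos (*-pos (0<ι 3) (ℚ.<-≤-trans 0<1 1≤x)) (*-pos 0<i 0<i)
      ½≤ : ½ ≤ 1ℚ - p
      ½≤ = ≤-from-diff (½ - p) (0≤diff (ℚ.≤-trans (^2k≤ 0≤w w<1 N) small))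
        (solve 1 (λ p → con ½ :+ (con ½ :- p) := con 1ℚ :- p) refl p)
      bound : c * ¼ ≤ c * d
      bound = begin
        c * ¼
          ≡⟨ solve 2 (λ x i → con (ι 4) :* x :* (i :* i) :* con ¼ := x :* i :* i) refl x i ⟩
        x * i * i
          ≤⟨ *-monoˡ (*-nonNeg 0≤x 0≤i) i≤2j ⟩
        x * i * (ι 2 * j)
          ≡⟨ solve 3 (λ x i j → x :* i :* (con (ι 2) :* j) := con (ι 2) :* (con (ι 2) :* x :* (i :* j)) :* con ½)
               refl x i j ⟩
        ι 2 * (ι 2 * x * (i * j)) * ½
          ≡⟨ cong (λ t → ι 2 * t * ½) (sym z-w≡) ⟩
        ι 2 * (z - w) * ½
          ≤⟨ *-monoˡ (*-nonNeg (0≤ι 2) 0≤z-w) ½≤ ⟩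
        ι 2 * (z - w) * (1ℚ - p)
          ≤⟨ sum-growth N ⟩
        (1ℚ - w * w) * d
          ≡⟨ cong (_* d) 1-ww≡ ⟩
        c * d ∎

    doubling-≥ : ∃[ M ] (∀ N → M ℕ.≤ N → atanhSum N w + ¼ ≤ atanhSum N z)
    doubling-≥ = after (geometric-small 0≤w w<1 ½ 0<½)
      where
      after : ∃[ M ] w ^ M ≤ ½ → ∃[ M ] (∀ N → M ℕ.≤ N → atanhSum N w + ¼ ≤ atanhSum N z)
      after (M , small) = M , λ N M≤N → doubling-≥-after N (ℚ.≤-trans
        (subst (λ e → w ^ e ≤ w ^ M) (ℕ.m∸n+n≡m M≤N) (^-anti 0≤w (ℚ.<⇒≤ w<1) (N ℕ.∸ M) M)) small)

  atanhSum-zero : ∀ N → atanhSum N 0ℚ ≡ 0ℚ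
  atanhSum-zero zero    = refl
  atanhSum-zero (suc N) = cong₂ _+_ (atanhSum-zero N) (begin
    ι 2 * (0ℚ * 0ℚ ^ (2 ℕ.* N)) * r ≡⟨ cong (λ t → ι 2 * t * r) (ℚ.*-zeroˡ (0ℚ ^ (2 ℕ.* N))) ⟩
    ι 2 * 0ℚ * r                    ≡⟨ ℚ.*-zeroˡ r ⟩
    0ℚ                              ∎)
    where
    open ≡-Reasoning
    r : ℚ
    r = inv (ι (suc (2 ℕ.* N)))

  logSum : ℕ → ℚ → ℚ
  logSum N q = atanhSum N (atanhArg q)

  1≤2^ : ∀ L → 1ℚ ≤ ι (2 ℕ.^ L)
  1≤2^ L = ι-mono {1} {2 ℕ.^ L} (ℕ.m^n>0 2 L)

  logSum-2^-≤ : ∀ N L → logSum N (ι (2 ℕ.^ L)) ≤ ι 2 * ι L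
  -- `atanhArg 1` evaluates to 0.
  logSum-2^-≤ N zero    = ℚ.≤-reflexive (atanhSum-zero N)
  logSum-2^-≤ N (suc L) = begin
    logSum N (ι (2 ℕ.* 2 ℕ.^ L))  ≡⟨ cong (logSum N) (ι-* 2 (2 ℕ.^ L)) ⟩
    logSum N (ι 2 * ι (2 ℕ.^ L))  ≤⟨ Doubling.doubling-≤ (1≤2^ L) N ⟩
    logSum N (ι (2 ℕ.^ L)) + ι 2  ≤⟨ ℚ.+-monoˡ-≤ (ι 2) (logSum-2^-≤ N L) ⟩
    ι 2 * ι L + ι 2               ≡⟨ solve 1 (λ l → con (ι 2) :* l :+ con (ι 2) := con (ι 2) :* (l :+ con 1ℚ)) refl (ι L) ⟩
    ι 2 * (ι L + 1ℚ)              ≡⟨ cong (ι 2 *_) (sym (ι-suc L)) ⟩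
    ι 2 * ι (suc L)               ∎
    where open ℚ.≤-Reasoning

  -- The threshold `M` depends on `L`, because `w` tends to 1 as `L` grows. This is harmless: `L`
  -- comes from `n`, which is fixed before the index of the Cauchy sequences.
  logSum-2^-≥ : ∀ L → ∃[ M ] (∀ N → M ℕ.≤ N → ι L * ¼ ≤ logSum N (ι (2 ℕ.^ L)))
  logSum-2^-≥ zero    = 0 , λ N _ → ℚ.≤-reflexive (sym (atanhSum-zero N))
  logSum-2^-≥ (suc L) = doubled (logSum-2^-≥ L) (Doubling.doubling-≥ (1≤2^ L))
    where
    doubled : ∃[ M ] (∀ N → M ℕ.≤ N → ι L * ¼ ≤ logSum N (ι (2 ℕ.^ L))) →
              ∃[ M ] (∀ N → M ℕ.≤ N → logSum N (ι (2 ℕ.^ L)) + ¼ ≤ logSum N (ι 2 * ι (2 ℕ.^ L))) →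
              ∃[ M ] (∀ N → M ℕ.≤ N → ι (suc L) * ¼ ≤ logSum N (ι (2 ℕ.^ suc L)))
    doubled (M₁ , below) (M₂ , doubling) = M₁ ℕ.⊔ M₂ , λ N hN → begin
      ι (suc L) * ¼                 ≡⟨ cong (_* ¼) (ι-suc L) ⟩
      (ι L + 1ℚ) * ¼                ≡⟨ solve 1 (λ l → (l :+ con 1ℚ) :* con ¼ := l :* con ¼ :+ con ¼) refl (ι L) ⟩
      ι L * ¼ + ¼                   ≤⟨ ℚ.+-monoˡ-≤ ¼ (below N (m≤o₁ M₁ M₂ hN)) ⟩
      logSum N (ι (2 ℕ.^ L)) + ¼    ≤⟨ doubling N (m≤o₂ M₁ M₂ hN) ⟩
      logSum N (ι 2 * ι (2 ℕ.^ L))  ≡⟨ cong (logSum N) (sym (ι-* 2 (2 ℕ.^ L))) ⟩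
      logSum N (ι (2 ℕ.^ suc L))    ∎
      where open ℚ.≤-Reasoning

  logSum-mono : ∀ N {p q} → 1ℚ ≤ p → p ≤ q → logSum N p ≤ logSum N q
  logSum-mono N 1≤p p≤q = atanhSum-mono N (Doubling.0≤w 1≤p)
    (atanhArg-mono (ℚ.≤-trans (ℚ.<⇒≤ 0<1) 1≤p) p≤q)

  -- At index `N` both logarithms are truncated to `N` terms. Then ln n lies between L/4 and 2(L+1)
  -- ≤ 4L; the lower bound is at least 2^l, so ln ln n ≥ l/4, and the quotient is at most 16L/l.
  ratio-bound : ∀ {n L l B N} → 1 ℕ.≤ l → 2 ℕ.^ L ℕ.≤ n → n ℕ.≤ 2 ℕ.^ suc L → 2 ℕ.^ (2 ℕ.+ l) ℕ.≤ L →
    16 ℕ.* L ℕ.≤ B ℕ.* B ℕ.* l →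
    proj₁ (logSum-2^-≥ L) ℕ.≤ N → proj₁ (logSum-2^-≥ l) ℕ.≤ N →
    logSum N (ι n) * inv (logSum N (logSum N (ι n))) ≤ ι B * ι B
  ratio-bound {n} {L} {l} {B} {N} 1≤l 2^L≤n n≤ 2^l≤L 16L≤ M≤N M′≤N = begin
    a * inv b
      ≤⟨ *-monoʳ (0≤inv 0<b) a≤Xb ⟩
    ι B * ι B * b * inv b
      ≡⟨ ℚ.*-assoc (ι B * ι B) b (inv b) ⟩
    ι B * ι B * (b * inv b)
      ≡⟨ cong (ι B * ι B *_) (*-inv 0<b) ⟩
    ι B * ι B * 1ℚ
      ≡⟨ ℚ.*-identityʳ (ι B * ι B) ⟩
    ι B * ι B ∎
    where
    open ℚ.≤-Reasoning
    a b : ℚ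
    a = logSum N (ι n)
    b = logSum N a
    a≥ : ι L * ¼ ≤ a
    a≥ = ℚ.≤-trans (proj₂ (logSum-2^-≥ L) N M≤N) (logSum-mono N (1≤2^ L) (ι-mono 2^L≤n))
    2^l≤a : ι (2 ℕ.^ l) ≤ a
    2^l≤a = begin
      ι (2 ℕ.^ l)                    ≡⟨ solve 1 (λ p → p := con (ι 2) :* (con (ι 2) :* p) :* con ¼) refl (ι (2 ℕ.^ l)) ⟩
      ι 2 * (ι 2 * ι (2 ℕ.^ l)) * ¼  ≡⟨ cong (λ t → ι 2 * t * ¼) (sym (ι-* 2 (2 ℕ.^ l))) ⟩
      ι 2 * ι (2 ℕ.^ suc l) * ¼      ≡⟨ cong (_* ¼) (sym (ι-* 2 (2 ℕ.^ suc l))) ⟩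
      ι (2 ℕ.^ (2 ℕ.+ l)) * ¼        ≤⟨ *-monoʳ (ℚ.<⇒≤ 0<¼) (ι-mono 2^l≤L) ⟩
      ι L * ¼                        ≤⟨ a≥ ⟩
      a                              ∎
    b≥ : ι l * ¼ ≤ b
    b≥ = ℚ.≤-trans (proj₂ (logSum-2^-≥ l) N M′≤N) (logSum-mono N (1≤2^ l) 2^l≤a)
    0<b : 0ℚ < b
    0<b = ℚ.<-≤-trans (*-pos (ℚ.<-≤-trans 0<1 (ι-mono 1≤l)) 0<¼) b≥
    1≤L : 1 ℕ.≤ L
    1≤L = ℕ.≤-trans (ℕ.m^n>0 2 (2 ℕ.+ l)) 2^l≤L
    a≤Xb : a ≤ ι B * ι B * b
    a≤Xb = begin
      a                          ≤⟨ logSum-mono N (ℚ.≤-trans (1≤2^ L) (ι-mono 2^L≤n)) (ι-mono n≤) ⟩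
      logSum N (ι (2 ℕ.^ suc L)) ≤⟨ logSum-2^-≤ N (suc L) ⟩
      ι 2 * ι (suc L)            ≡⟨ cong (ι 2 *_) (ι-suc L) ⟩
      ι 2 * (ι L + 1ℚ)           ≤⟨ *-monoˡ (0≤ι 2) (ℚ.+-monoʳ-≤ (ι L) (ι-mono 1≤L)) ⟩
      ι 2 * (ι L + ι L)          ≡⟨ solve 1 (λ t → con (ι 2) :* (t :+ t) := con (ι 16) :* t :* con ¼) refl (ι L) ⟩
      ι 16 * ι L * ¼             ≡⟨ cong (_* ¼) (sym (ι-* 16 L)) ⟩
      ι (16 ℕ.* L) * ¼           ≤⟨ *-monoʳ (ℚ.<⇒≤ 0<¼) (ι-mono 16L≤) ⟩
      ι (B ℕ.* B ℕ.* l) * ¼      ≡⟨ cong (_* ¼) (trans (ι-* (B ℕ.* B) l) (cong (_* ι l) (ι-* B B))) ⟩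
      ι B * ι B * ι l * ¼        ≡⟨ ℚ.*-assoc (ι B * ι B) (ι l) ¼ ⟩
      ι B * ι B * (ι l * ¼)      ≤⟨ *-monoˡ (*-nonNeg (0≤ι B) (0≤ι B)) b≥ ⟩
      ι B * ι B * b              ∎

  -- If the root `s` exceeded `b`, it would be positive and hence no default value, so s² ≤ q ≤ b² <
  -- s².
  sqrtBelow≤ : ∀ N {q b} → 0ℚ ≤ b → q ≤ b * b → sqrtBelow N q ≤ b
  sqrtBelow≤ N {q} {b} 0≤b q≤bb with sqrtBelow N q ℚ.≤? b
  ... | yes s≤b = s≤b
  ... | no s≰b  = contradiction (begin-strict
      b * b  ≤⟨ *-monoʳ 0≤b (ℚ.<⇒≤ b<s) ⟩
      s * b  <⟨ ℚ.*-monoʳ-<-pos s {{ℚ.positive 0<s}} b<s ⟩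
      s * s  ≤⟨ sqrtBelow-lower N q 0<s ⟩
      q      ≤⟨ q≤bb ⟩
      b * b  ∎) (ℚ.<-irrefl refl)
    where
    open ℚ.≤-Reasoning
    s : ℚ
    s = sqrtBelow N q
    b<s : b < s
    b<s = ℚ.≰⇒> s≰b
    0<s : 0ℚ < s
    0<s = ℚ.≤-<-trans 0≤b b<s

  -- The left-hand sequence unfolds at each `N` to the rational expression bounded above, so only
  -- the thresholds of the two lower bounds enter.
  √-ratio-bound : ∀ {n L l B K f} (3≤n : 3 ℕ.≤ n) → 1 ℕ.≤ l → 2 ℕ.^ L ℕ.≤ n → n ℕ.≤ 2 ℕ.^ suc L →
    2 ℕ.^ (2 ℕ.+ l) ℕ.≤ L → 16 ℕ.* L ℕ.≤ B ℕ.* B ℕ.* l → 1 ℕ.≤ K → B ℕ.≤ K ℕ.* f →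
    fromℚ (inv (ι K)) *ℝ √ (divide (lnℕ n 3≤n) (lnlnℕ n 3≤n) (0<lnlnℕ n 3≤n)) ≤ℝ fromℕ f
  √-ratio-bound {n} {L} {l} {B} {K} {f} 3≤n 1≤l 2^L≤n n≤ 2^l≤L 16L≤ 1≤K B≤ ε 0<ε = M ℕ.⊔ M′ , λ N hN → begin
    inv (ι K) * sqrtBelow N (logSum N (ι n) * inv (logSum N (logSum N (ι n))))
      ≤⟨ *-monoˡ (0≤inv 0<K) (sqrtBelow≤ N (0≤ι B)
           (ratio-bound {n} {L} {l} {B} 1≤l 2^L≤n n≤ 2^l≤L 16L≤ (m≤o₁ M M′ hN) (m≤o₂ M M′ hN))) ⟩
    inv (ι K) * ι B          ≤⟨ *-monoˡ (0≤inv 0<K) (ι-mono B≤) ⟩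
    inv (ι K) * ι (K ℕ.* f)  ≡⟨ cong (inv (ι K) *_) (ι-* K f) ⟩
    inv (ι K) * (ι K * ι f)  ≡⟨ solve 3 (λ i k f → i :* (k :* f) := k :* i :* f) refl (inv (ι K)) (ι K) (ι f) ⟩
    ι K * inv (ι K) * ι f    ≡⟨ cong (_* ι f) (*-inv 0<K) ⟩
    1ℚ * ι f                 ≡⟨ ℚ.*-identityˡ (ι f) ⟩
    ι f                      ≤⟨ ≤-from-diff ε (ℚ.<⇒≤ 0<ε) refl ⟩
    ι f + ε                  ∎
    where
    open ℚ.≤-Reasoning
    M M′ : ℕ
    M  = proj₁ (logSum-2^-≥ L)
    M′ = proj₁ (logSum-2^-≥ l)
    0<K : 0ℚ < ι K
    0<K = ℚ.<-≤-trans 0<1 (ι-mono 1≤K)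

open import Data.Nat.Base hiding (_/_)
open import Data.Nat.Properties

-- Ramsey's theorem

length-split : ∀ {A : Set} {P : A → Set} (P? : ∀ x → Dec (P x)) xs →
  length xs ≡ length (filter P? xs) + length (filter (¬? ∘ P?) xs)
length-split P? [] = refl
length-split P? (x ∷ xs) with P? x
... | yes _ = cong suc (length-split P? xs)
... | no _  = trans (cong suc (length-split P? xs)) (sym (+-suc _ _))

-- If the class of the top colour has fewer than `m` entries, enough remain for the other colours.
-- The class is returned as a sublist, so that the order of the vertices survives.
pigeonhole : ∀ {A : Set} (g : A → ℕ) k m xs → All (λ x → g x < suc k) xs → suc k * m ≤ length xs →
  ∃[ c ] c ≤ k × ∃[ ys ] ys ⊆ xs × m ≤ length ys × All (λ y → g y ≡ c) ys
pigeonhole g zero m xs bounded m≤ =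
  0 , z≤n , xs , ⊆-refl , subst (_≤ length xs) (*-identityˡ m) m≤ , All.map (n<1⇒n≡0) bounded
pigeonhole g (suc k) m xs bounded m≤ with m ≤? length (filter (λ x → g x ≟ suc k) xs)
... | yes m≤class = suc k , ≤-refl , _ , Sublist.filter-⊆ _ xs , m≤class , All.all-filter _ xs
... | no m≰class =
  let c , c≤k , ys , ys⊆ , m≤ys , mono = pigeonhole g k m others others-bounded enough in
  c , m≤n⇒m≤1+n c≤k , ys , ⊆-trans ys⊆ (Sublist.filter-⊆ _ xs) , m≤ys , mono
  where
  others = filter (λ x → ¬? (g x ≟ suc k)) xs
  others-bounded : All (λ x → g x < suc k) others
  others-bounded = All.zipWith (λ (≢k , ≤k) → ≤∧≢⇒< (s≤s⁻¹ ≤k) ≢k)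
    (All.all-filter _ xs , All.filter⁺ _ bounded)
  enough : suc k * m ≤ length others
  enough = +-cancelˡ-≤ m _ _ (≤-trans m≤ (≤-trans (≤-reflexive (length-split _ xs))
    (+-monoˡ-≤ (length others) (<⇒≤ (≰⇒> m≰class)))))

-- Curried, so that fixing the first entry of a tuple is application. Only tuples in list order are
-- ever compared.
Colouring : Set → ℕ → ℕ → Set
Colouring A zero    k = Fin k
Colouring A (suc r) k = A → Colouring A r k

Homogeneous : ∀ {A k} r → Colouring A r k → Fin k → List A → Set
Homogeneous zero    f c xs       = f ≡ c
Homogeneous (suc r) f c []       = ⊤
Homogeneous (suc r) f c (x ∷ xs) = Homogeneous r (f x) c xs × Homogeneous (suc r) f c xs

homogeneous-⊆ : ∀ {A k} r {f : Colouring A r k} {c xs ys} → ys ⊆ xs →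
                Homogeneous r f c xs → Homogeneous r f c ys
homogeneous-⊆ zero    _            h       = h
homogeneous-⊆ (suc r) []           h       = tt
homogeneous-⊆ (suc r) (_ ∷ʳ ys⊆)   (_ , h) = homogeneous-⊆ (suc r) ys⊆ h
homogeneous-⊆ (suc r) (refl ∷ ys⊆) (p , h) = homogeneous-⊆ r ys⊆ p , homogeneous-⊆ (suc r) ys⊆ h

-- The colour of a tuple depends on its first entry alone, and each entry carries that colour.
EndHomogeneous : ∀ {A k} r → Colouring A (suc r) k → List (A × Fin k) → Set
EndHomogeneous r f []             = ⊤
EndHomogeneous r f ((x , c) ∷ ps) = Homogeneous r (f x) c (map proj₁ ps) × EndHomogeneous r f ps

endHomogeneous-⊆ : ∀ {A k} r {f : Colouring A (suc r) k} {ps qs} → qs ⊆ ps →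
                   EndHomogeneous r f ps → EndHomogeneous r f qs
endHomogeneous-⊆ r []           h       = tt
endHomogeneous-⊆ r (_ ∷ʳ qs⊆)   (_ , h) = endHomogeneous-⊆ r qs⊆ h
endHomogeneous-⊆ r (refl ∷ qs⊆) (p , h) =
  homogeneous-⊆ r (Sublist.map⁺ proj₁ qs⊆) p , endHomogeneous-⊆ r qs⊆ h

endHomogeneous⇒homogeneous : ∀ {A k} r {f : Colouring A (suc r) k} {c} ps →
  All (λ p → proj₂ p ≡ c) ps → EndHomogeneous r f ps → Homogeneous (suc r) f c (map proj₁ ps)
endHomogeneous⇒homogeneous r []       _            _       = tt
endHomogeneous⇒homogeneous r (_ ∷ ps) (refl ∷ eqs) (p , h) = p , endHomogeneous⇒homogeneous r ps eqs h

-- There are `suc k` colours. `endRamsey k r j` entries suffice for an end-homogeneous list of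
-- length `j`: one first entry, then enough for the `r`-tuple theorem to leave room for the rest.
mutual
  ramsey : ℕ → ℕ → ℕ → ℕ
  ramsey k zero    m = m
  ramsey k (suc r) m = endRamsey k r (suc k * m)

  endRamsey : ℕ → ℕ → ℕ → ℕ
  endRamsey k r zero    = zero
  endRamsey k r (suc j) = suc (ramsey k r (endRamsey k r j))

RamseyProperty : ℕ → ℕ → Set₁
RamseyProperty k r = ∀ {A : Set} m xs (f : Colouring A r (suc k)) → ramsey k r m ≤ length xs →
  ∃[ ys ] ys ⊆ xs × m ≤ length ys × ∃[ c ] Homogeneous r f c ys

-- The first entry `x` induces the colouring `f x` of `r`-tuples; the construction continues inside
-- a sublist homogeneous for it.
endHomogeneous-exists : ∀ {A : Set} k r → RamseyProperty k r →
  ∀ j xs (f : Colouring A (suc r) (suc k)) → endRamsey k r j ≤ length xs →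
  ∃[ ps ] map proj₁ ps ⊆ xs × j ≤ length ps × EndHomogeneous r f ps
endHomogeneous-exists k r R zero xs f _ = [] , Sublist.[]⊆-universal xs , z≤n , tt
endHomogeneous-exists k r R (suc j) (x ∷ xs) f (s≤s enough) =
  let ys , ys⊆ , j≤ys , c , hom = R (endRamsey k r j) xs (f x) enough
      ps , ps⊆ , j≤ps , end = endHomogeneous-exists k r R j ys f j≤ys
  in (x , c) ∷ ps , refl ∷ ⊆-trans ps⊆ ys⊆ , s≤s j≤ps , homogeneous-⊆ r ps⊆ hom , end

-- Pigeonhole on the recorded colours turns an end-homogeneous list into a homogeneous one.
ramsey-theorem : ∀ k r → RamseyProperty k r
ramsey-theorem k zero    m xs f m≤ = xs , ⊆-refl , m≤ , f , refl
ramsey-theorem k (suc r) m xs f m≤ =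
  let ps , ps⊆ , enough , end = endHomogeneous-exists k r (ramsey-theorem k r) (suc k * m) xs f m≤
      c , c≤k , qs , qs⊆ , m≤qs , mono =
        pigeonhole (toℕ ∘ proj₂) k m ps (All.universal (λ p → Fin.toℕ<n (proj₂ p)) ps) enough
  in map proj₁ qs , ⊆-trans (Sublist.map⁺ proj₁ qs⊆) ps⊆
   , subst (m ≤_) (sym (List.length-map proj₁ qs)) m≤qs
   , fromℕ< (s≤s c≤k)
   , endHomogeneous⇒homogeneous r qs
       (All.map (λ eq → Fin.toℕ-injective (trans eq (sym (Fin.toℕ-fromℕ< (s≤s c≤k))))) mono)
       (endHomogeneous-⊆ r qs⊆ end)

endRamsey-zero : ∀ k j → endRamsey k 0 j ≡ j
endRamsey-zero k zero    = refl
endRamsey-zero k (suc j) = cong suc (endRamsey-zero k j)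

-- For pairs the recurrence is a ↦ 1 + (k+1)a; the summand 1 is absorbed by a power of k+2.
endRamsey-one : ∀ k j → endRamsey k 1 j ≤ suc (suc k) ^ j
endRamsey-one k zero    = z≤n
endRamsey-one k (suc j) = begin
  suc (endRamsey k 0 (suc k * endRamsey k 1 j)) ≡⟨ cong suc (endRamsey-zero k _) ⟩
  suc (suc k * endRamsey k 1 j)                 ≤⟨ +-mono-≤ (m^n>0 (suc (suc k)) j)
                                                     (*-monoʳ-≤ (suc k) (endRamsey-one k j)) ⟩
  suc (suc k) ^ suc j                           ∎
  where open ≤-Reasoning

ramsey-pairs : ∀ k m → ramsey k 2 m ≤ suc (suc k) ^ (suc k * m)
ramsey-pairs k m = endRamsey-one k (suc k * m)

TripleRamsey : ℕ → ℕ → Set₁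
TripleRamsey m T = ∀ {A : Set} xs (f : Colouring A 3 2) → T ≤ length xs →
  ∃[ ys ] ys ⊆ xs × m ≤ length ys × ∃[ t ] Homogeneous 3 f t ys

triple-ramsey : ∀ m → ∃[ T ] 1 ≤ T × TripleRamsey m T
-- The successor makes `1 ≤ T` immediate.
triple-ramsey m = suc (ramsey 1 3 m) , s≤s z≤n , λ xs f enough →
  ramsey-theorem 1 3 m xs f (≤-trans (n≤1+n (ramsey 1 3 m)) enough)

-- Tight paths

TightPath : ∀ {n} → 3-Digraph n → List (Fin n) → Set
TightPath G (x ∷ y ∷ z ∷ xs) = T (edge G x y z) × TightPath G (y ∷ z ∷ xs)
TightPath G _                = ⊤

tightPath-list? : ∀ {n} (G : 3-Digraph n) → Decidable (TightPath G)
tightPath-list? G []               = yes tt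
tightPath-list? G (_ ∷ [])         = yes tt
tightPath-list? G (_ ∷ _ ∷ [])     = yes tt
tightPath-list? G (x ∷ y ∷ z ∷ xs) = T? (edge G x y z) ×-dec tightPath-list? G (y ∷ z ∷ xs)

tightPath-lookup : ∀ {n} (G : 3-Digraph n) xs → TightPath G xs → ∀ i j k →
  toℕ j ≡ suc (toℕ i) → toℕ k ≡ suc (toℕ j) → T (edge G (lookup xs i) (lookup xs j) (lookup xs k))
tightPath-lookup G (x ∷ y ∷ z ∷ xs) (e , _) zero (suc zero) (suc (suc zero)) _ _ = e
tightPath-lookup G (x ∷ y ∷ z ∷ xs) (_ , p) (suc i) (suc j) (suc k) j≡1+i k≡1+j =
  tightPath-lookup G (y ∷ z ∷ xs) p i j k (suc-injective j≡1+i) (suc-injective k≡1+j)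
tightPath-lookup G (x ∷ y ∷ [])     _ (suc zero) zero _ () _
tightPath-lookup G (x ∷ y ∷ [])     _ (suc zero) (suc zero) _ () _
tightPath-lookup G (x ∷ y ∷ [])     _ zero (suc zero) (suc zero) _ ()
tightPath-lookup G (x ∷ y ∷ [])     _ zero (suc zero) zero _ ()
tightPath-lookup G (x ∷ [])         _ zero zero _ () _

unique⇒lookup-injective : ∀ {A : Set} {xs : List A} → Unique xs → ∀ i j →
  lookup xs i ≡ lookup xs j → i ≡ j
unique⇒lookup-injective (x∉ ∷ _) zero    zero    _  = refl
unique⇒lookup-injective (x∉ ∷ _) zero    (suc j) eq = contradiction eq (All.lookup x∉ (∈-lookup j))
unique⇒lookup-injective (x∉ ∷ _) (suc i) zero    eq = contradiction (sym eq) (All.lookup x∉ (∈-lookup i))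
unique⇒lookup-injective (_ ∷ u)  (suc i) (suc j) eq = cong suc (unique⇒lookup-injective u i j eq)

list⇒contains : ∀ {n} (G : 3-Digraph n) {s} xs → TightPath G xs → Unique xs → s ≤ length xs →
                Contains G (tightPath s)
list⇒contains G {s} xs path unique s≤ = lookup xs ∘ position
  , (λ {i} {j} eq → Fin.inject≤-injective s≤ s≤ i j
      (unique⇒lookup-injective unique (position i) (position j) eq))
  , λ a b c e →
      let b≟1+a = toℕ b ≟ suc (toℕ a)
          c≟1+b = toℕ c ≟ suc (toℕ b)
          p , q = Equivalence.to (T-∧ {⌊ b≟1+a ⌋} {⌊ c≟1+b ⌋}) e
      in tightPath-lookup G xs path (position a) (position b) (position c)
           (step a b (toWitness {a? = b≟1+a} p)) (step b c (toWitness {a? = c≟1+b} q))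
  where
  position : Fin s → Fin (length xs)
  position i = inject≤ i s≤
  step : ∀ i j → toℕ j ≡ suc (toℕ i) → toℕ (position j) ≡ suc (toℕ (position i))
  step i j eq = trans (Fin.toℕ-inject≤ j s≤) (trans eq (cong suc (sym (Fin.toℕ-inject≤ i s≤))))

-- Makes the existence of a ray of given length decidable, so that labels can be computed.
anyOfLength? : ∀ {n} {P : List (Fin n) → Set} → Decidable P → ∀ ℓ → Dec (∃[ xs ] length xs ≡ ℓ × P xs)
anyOfLength? P? zero =
  map′ (λ p → [] , refl , p) (λ { ([] , _ , p) → p }) (P? [])
anyOfLength? P? (suc ℓ) =
  map′ (λ (x , xs , eq , p) → x ∷ xs , cong suc eq , p)
       (λ { (x ∷ xs , eq , p) → x , xs , suc-injective eq , p })
       (Fin.any? λ x → anyOfLength? (λ xs → P? (x ∷ xs)) ℓ)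

greatest≤ : ∀ {P : ℕ → Set} (P? : Decidable P) m → greatest P? m ≤ m
greatest≤ P? zero = z≤n
greatest≤ P? (suc m) with P? (suc m)
... | yes _ = ≤-refl
... | no _  = m≤n⇒m≤1+n (greatest≤ P? m)

-- Rays and the labels of pairs

module Labels {n} (G : 3-Digraph n) {s} (free : ¬ Contains G (tightPath s))
  {_≺_ : Rel (Fin n) 0ℓ} (≺-order : IsStrictPartialOrder _≡_ _≺_) (_≺?_ : Decidable₂ _≺_) where

  private module O = IsStrictPartialOrder ≺-order

  ≺⇒≢ : ∀ {x y} → x ≺ y → y ≢ x
  ≺⇒≢ x≺y refl = O.irrefl refl x≺y

  -- The exceptional vertex z is what allows the prefix y x w u of ray-extend₄ below.
  Ray : Fin n → Fin n → List (Fin n) → Set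
  Ray u v rest =
    TightPath G (v ∷ u ∷ rest) × Unique (v ∷ u ∷ rest) × All (_≺ v) (u ∷ rest) ×
    ∃[ z ] All (λ r → r ≡ z ⊎ r ≺ u) rest

  ray? : ∀ u v → Decidable (Ray u v)
  ray? u v rest = tightPath-list? G (v ∷ u ∷ rest)
    ×-dec AllPairs.allPairs? (λ x y → ¬? (x Fin.≟ y)) (v ∷ u ∷ rest)
    ×-dec All.all? (_≺? v) (u ∷ rest)
    ×-dec Fin.any? (λ z → All.all? (λ r → (r Fin.≟ z) ⊎-dec (r ≺? u)) rest)

  ray-[] : ∀ {u v} → u ≺ v → Ray u v []
  ray-[] {u} u≺v = tt , (≺⇒≢ u≺v ∷ []) ∷ [] ∷ [] , u≺v ∷ [] , u , []

  -- Every vertex of the old tail is below `v`, so the new ray has no exceptional vertex: the old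
  -- exception is forgiven and `u` merely fills the place.
  ray-extend : ∀ {u v w rest} → u ≺ v → v ≺ w → T (edge G w v u) → Ray u v rest → Ray v w (u ∷ rest)
  ray-extend {u} {v} {w} {rest} u≺v v≺w e (path , unique , below , _) =
    (e , path) , All.map ≺⇒≢ below-w ∷ unique , below-w , u , All.map inj₂ below
    where
    below-w : All (_≺ w) (v ∷ u ∷ rest)
    below-w = v≺w ∷ All.map (λ r≺v → O.trans r≺v v≺w) below

  -- Above `x` the new tail has only `w`, which becomes the exceptional vertex. The order settles
  -- all distinctness except that of `u` from `rest`.
  ray-extend₄ : ∀ {a u c x w y rest} → a ≺ u → u ≺ c → c ≺ x → x ≺ w → w ≺ y → All (u ≢_) rest →
    T (edge G u c a) → T (edge G w u c) → T (edge G x w u) → T (edge G y x w) →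
    Ray a c rest → Ray x y (w ∷ u ∷ c ∷ a ∷ rest)
  ray-extend₄ {a} {u} {c} {x} {w} {y} {rest} a≺u u≺c c≺x x≺w w≺y u∉ e₁ e₂ e₃ e₄ (path , unique , below , _) =
      (e₄ , e₃ , e₂ , e₁ , path)
    , (All.map ≺⇒≢ below-y
      ∷ (≺⇒≢ x≺w ∘ sym ∷ All.map ≺⇒≢ below-x)
      ∷ All.map (λ r≺x → ≺⇒≢ (O.trans r≺x x≺w)) below-x
      ∷ ((≺⇒≢ u≺c ∘ sym) ∷ ≺⇒≢ a≺u ∷ u∉)
      ∷ unique)
    , below-y
    , w , inj₁ refl ∷ All.map inj₂ below-x
    where
    below-x : All (_≺ x) (u ∷ c ∷ a ∷ rest)
    below-x = O.trans u≺c c≺x ∷ c≺x ∷ All.map (λ r≺c → O.trans r≺c c≺x) below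
    below-y : All (_≺ y) (x ∷ w ∷ u ∷ c ∷ a ∷ rest)
    below-y = O.trans x≺w w≺y ∷ w≺y ∷ All.map (λ r≺x → O.trans r≺x (O.trans x≺w w≺y)) below-x

  HasRay : Fin n → Fin n → ℕ → Set
  HasRay u v ℓ = ∃[ rest ] length rest ≡ ℓ × Ray u v rest

  hasRay? : ∀ u v → Decidable (HasRay u v)
  hasRay? u v ℓ = anyOfLength? (ray? u v) ℓ

  label : Fin n → Fin n → ℕ
  label u v = greatest (hasRay? u v) s

  label-holds : ∀ {u v} → u ≺ v → HasRay u v (label u v)
  label-holds {u} {v} u≺v = greatest-holds (hasRay? u v) s ([] , refl , ray-[] u≺v)

  -- The search for labels stops at `s`, but a longer ray would already contain the forbidden path.
  ray≤label : ∀ {u v rest} → Ray u v rest → length rest ≤ label u v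
  ray≤label {u} {v} {rest} ray@(path , unique , _) with length rest ≤? s
  ... | yes ≤s = greatest-upper (hasRay? u v) s (length rest) ≤s (rest , refl , ray)
  ... | no ≰s  = contradiction
    (list⇒contains G _ path unique (m≤n⇒m≤1+n (m≤n⇒m≤1+n (<⇒≤ (≰⇒> ≰s))))) free

  label-increases : ∀ {u v w} → u ≺ v → v ≺ w → T (edge G w v u) → label u v < label v w
  label-increases u≺v v≺w e =
    let rest , eq , ray = label-holds u≺v
    in subst (λ ℓ → suc ℓ ≤ _) eq (ray≤label (ray-extend u≺v v≺w e ray))

  -- The longest ray from (a , c) has at most one vertex outside {r : r ≺ a}, so one of
  -- u₁ and u₂ is free to prolong it.
  label-increases₄ : ∀ {a u₁ u₂ c x w y} →
    a ≺ u₁ → u₁ ≺ u₂ → u₂ ≺ c → c ≺ x → x ≺ w → w ≺ y →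
    (∀ {u} → u ≡ u₁ ⊎ u ≡ u₂ → T (edge G u c a) × T (edge G w u c) × T (edge G x w u)) →
    T (edge G y x w) → label a c < label x y
  label-increases₄ {a} {u₁} {u₂} {c} {x} {w} {y} a≺u₁ u₁≺u₂ u₂≺c c≺x x≺w w≺y edges e₄
    with label-holds (O.trans a≺u₁ (O.trans u₁≺u₂ u₂≺c))
  ... | rest , eq , ray@(_ , _ , _ , z , near) = choose (u₁ Fin.≟ z)
    where
    prolong : ∀ {u} → a ≺ u → u ≺ c → u ≢ z → u ≡ u₁ ⊎ u ≡ u₂ → label a c < label x y
    prolong {u} a≺u u≺c u≢z u∈ =
      let e₁ , e₂ , e₃ = edges u∈
          longer = ray≤label (ray-extend₄ a≺u u≺c c≺x x≺w w≺y u∉ e₁ e₂ e₃ e₄ ray)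
      in subst (λ ℓ → suc ℓ ≤ label x y) eq (≤-trans (s≤s (m≤n+m _ 3)) longer)
      where
      u∉ : All (u ≢_) rest
      u∉ = All.map (λ { (inj₁ r≡z) u≡r → u≢z (trans u≡r r≡z)
                      ; (inj₂ r≺a) u≡r → ≺⇒≢ (O.trans r≺a a≺u) u≡r }) near
    choose : Dec (u₁ ≡ z) → label a c < label x y
    choose (no u₁≢z)   = prolong a≺u₁ (O.trans u₁≺u₂ u₂≺c) u₁≢z (inj₁ refl)
    choose (yes u₁≡z) = prolong (O.trans a≺u₁ u₁≺u₂) u₂≺c
      (λ u₂≡z → ≺⇒≢ u₁≺u₂ (trans u₂≡z (sym u₁≡z))) (inj₂ refl)

  labelColour : Fin n → Fin n → Fin (suc s)
  labelColour u v = fromℕ< (s≤s (greatest≤ (hasRay? u v) s))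

  labelColour-label : ∀ {u v u′ v′} → labelColour u v ≡ labelColour u′ v′ → label u v ≡ label u′ v′
  labelColour-label {u} {v} {u′} {v′} eq =
    trans (sym (Fin.toℕ-fromℕ< (s≤s (greatest≤ (hasRay? u v) s))))
      (trans (cong toℕ eq) (Fin.toℕ-fromℕ< (s≤s (greatest≤ (hasRay? u′ v′) s))))

-- Homogeneous sets in a (3,3)-tournament

bit : Bool → ℕ
bit true  = 1
bit false = 0

length-filterᵇ : ∀ {A : Set} (p : A → Bool) xs → length (filterᵇ p xs) ≡ sum (map (bit ∘ p) xs)
length-filterᵇ p [] = refl
length-filterᵇ p (x ∷ xs) with p x
... | true  = cong suc (length-filterᵇ p xs)
... | false = length-filterᵇ p xs

-- Of the four orderings left exactly one is missing. If it is `b c a` or `c a b`, the other two are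
-- edges.
three-of-four : ∀ {n} (G : 3-Digraph n) → IsTournament 3 G → ∀ {a b c} → a ≢ b → b ≢ c → a ≢ c →
  ¬ T (edge G a b c) → ¬ T (edge G c b a) → edge G b c a ∧ edge G c a b ≡ false →
  T (edge G a c b) × T (edge G b a c)
-- The edge count is abstracted together with the six Booleans, so that impossible assignments
-- become false numerical equations.
three-of-four G tour {a} {b} {c} a≢b b≢c a≢c ¬abc ¬cba ¬both
  with edge G a b c | edge G a c b | edge G b a c | edge G b c a | edge G c a b | edge G c b a
     | trans (sym (length-filterᵇ (λ (x , y , z) → edge G x y z) (orderings a b c))) (tour a b c a≢b b≢c a≢c)
... | true  | _ | _ | _ | _ | _ | _ = contradiction tt ¬abc
... | false | _ | _ | _ | _ | true | _ = contradiction tt ¬cba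
... | false | true | true | _ | _ | false | _ = tt , tt
... | false | _     | _     | true  | true | false | _ with () ← ¬both
... | false | true  | false | false | true  | false | ()
... | false | true  | false | true  | false | false | ()
... | false | true  | false | false | false | false | ()
... | false | false | true  | false | true  | false | ()
... | false | false | true  | true  | false | false | ()
... | false | false | true  | false | false | false | ()
... | false | false | false | false | true  | false | ()
... | false | false | false | true  | false | false | ()
... | false | false | false | false | false | false | ()

allPairs-⊆ : ∀ {A : Set} {R : Rel A 0ℓ} {xs ys} → ys ⊆ xs → AllPairs R xs → AllPairs R ys
allPairs-⊆ []           []       = []
allPairs-⊆ (_ ∷ʳ ys⊆)   (_ ∷ ps) = allPairs-⊆ ys⊆ ps
allPairs-⊆ (refl ∷ ys⊆) (p ∷ ps) = Sublist.All-resp-⊆ ys⊆ p ∷ allPairs-⊆ ys⊆ ps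

homogeneous-pair : ∀ {A k} {f : Colouring A 2 k} {c xs x y} → x ∷ y ∷ [] ⊆ xs →
                   Homogeneous 2 f c xs → f x y ≡ c
homogeneous-pair {f = f} xy⊆ h = proj₁ (proj₁ (homogeneous-⊆ 2 {f} xy⊆ h))

homogeneous-triple : ∀ {A k} {f : Colouring A 3 k} {c xs x y z} → x ∷ y ∷ z ∷ [] ⊆ xs →
                     Homogeneous 3 f c xs → f x y z ≡ c
homogeneous-triple {f = f} xyz⊆ h = proj₁ (proj₁ (proj₁ (homogeneous-⊆ 3 {f} xyz⊆ h)))

module NoLongPath {n} (G : 3-Digraph n) (tour : IsTournament 3 G) {s} (free : ¬ Contains G (tightPath s)) where

  -- The same theory for the order of the vertices and for its reverse.
  module Up   = Labels G free Fin.<-isStrictPartialOrder Fin._<?_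
  module Down = Labels G free (flip-isStrictPartialOrder Fin.<-isStrictPartialOrder) (flip Fin._<?_)

  pairColour : Colouring (Fin n) 2 (suc s * suc s)
  pairColour x y = combine (Up.labelColour x y) (Down.labelColour y x)

  -- The second colour records only that the first alternative fails; the other alternative then
  -- follows from `three-of-four` once the labels are constant.
  tripleColour : Colouring (Fin n) 3 2
  tripleColour a b c with edge G b c a ∧ edge G c a b
  ... | true  = zero
  ... | false = suc zero

  pairColour-up : ∀ {x y x′ y′ c} → pairColour x y ≡ c → pairColour x′ y′ ≡ c → Up.label x y ≡ Up.label x′ y′
  pairColour-up {x} {y} {x′} {y′} p q = Up.labelColour-label (Fin.combine-injectiveˡ
    (Up.labelColour x y) (Down.labelColour y x) (Up.labelColour x′ y′) (Down.labelColour y′ x′) (trans p (sym q)))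

  pairColour-down : ∀ {x y x′ y′ c} → pairColour x y ≡ c → pairColour x′ y′ ≡ c → Down.label y x ≡ Down.label y′ x′
  pairColour-down {x} {y} {x′} {y′} p q = Down.labelColour-label (Fin.combine-injectiveʳ
    (Up.labelColour x y) (Down.labelColour y x) (Up.labelColour x′ y′) (Down.labelColour y′ x′) (trans p (sym q)))

  tripleColour-zero : ∀ a b c → tripleColour a b c ≡ zero → T (edge G b c a) × T (edge G c a b)
  tripleColour-zero a b c eq with edge G b c a | edge G c a b
  tripleColour-zero a b c eq | true | true = tt , tt
  tripleColour-zero a b c () | true | false
  tripleColour-zero a b c () | false | _

  tripleColour-suc : ∀ a b c → tripleColour a b c ≡ suc zero → edge G b c a ∧ edge G c a b ≡ false
  tripleColour-suc a b c eq with edge G b c a ∧ edge G c a b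
  ... | false = refl

  module _ {a u₁ u₂ c x w y vs p t}
    (increasing : AllPairs Fin._<_ (a ∷ u₁ ∷ u₂ ∷ c ∷ x ∷ w ∷ y ∷ vs))
    (pairs : Homogeneous 2 pairColour p (a ∷ u₁ ∷ u₂ ∷ c ∷ x ∷ w ∷ y ∷ vs))
    (triples : Homogeneous 3 tripleColour t (a ∷ u₁ ∷ u₂ ∷ c ∷ x ∷ w ∷ y ∷ vs)) where

    all : List (Fin n)
    all = a ∷ u₁ ∷ u₂ ∷ c ∷ x ∷ w ∷ y ∷ vs

    pair-< : ∀ {i j} → i ∷ j ∷ [] ⊆ all → i Fin.< j
    pair-< ij⊆ with (i<j ∷ _) ∷ _ ← allPairs-⊆ ij⊆ increasing = i<j

    up-triple : t ≡ zero → ∀ {i j k} → i ∷ j ∷ k ∷ [] ⊆ all → T (edge G j k i) × T (edge G k i j)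
    up-triple refl {i} {j} {k} ijk⊆ = tripleColour-zero i j k (homogeneous-triple {f = tripleColour} ijk⊆ triples)

    -- With constant labels, an edge `i j k` would raise the label of the reversed order from
    -- `(k , j)` to `(j , i)`, and `k j i` would raise the other label from `(i , j)` to `(j , k)`.
    down-triple : t ≡ suc zero → ∀ {i j k} → i ∷ j ∷ k ∷ [] ⊆ all → T (edge G i k j) × T (edge G j i k)
    down-triple refl {i} {j} {k} ijk⊆ = three-of-four G tour
      (Up.≺⇒≢ i<j ∘ sym) (Up.≺⇒≢ j<k ∘ sym) (Up.≺⇒≢ (Fin.<-trans i<j j<k) ∘ sym)
      (λ e → <-irrefl (pairColour-down colour-jk colour-ij) (Down.label-increases j<k i<j e))
      (λ e → <-irrefl (pairColour-up colour-ij colour-jk) (Up.label-increases i<j j<k e))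
      (tripleColour-suc i j k (homogeneous-triple {f = tripleColour} ijk⊆ triples))
      where
      ij⊆ : i ∷ j ∷ [] ⊆ all
      ij⊆ = ⊆-trans (refl ∷ refl ∷ k ∷ʳ []) ijk⊆
      jk⊆ : j ∷ k ∷ [] ⊆ all
      jk⊆ = ⊆-trans (i ∷ʳ refl ∷ refl ∷ []) ijk⊆
      i<j : i Fin.< j
      i<j = pair-< ij⊆
      j<k : j Fin.< k
      j<k = pair-< jk⊆
      colour-ij : pairColour i j ≡ p
      colour-ij = homogeneous-pair {f = pairColour} ij⊆ pairs
      colour-jk : pairColour j k ≡ p
      colour-jk = homogeneous-pair {f = pairColour} jk⊆ pairs

    -- The path `y x w u c a` uses both edges of the first alternative: `u c a` and `x w u` begin
    -- with the middle vertex of their triple, `w u c` and `y x w` with the largest.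
    up-impossible : ¬ t ≡ zero
    up-impossible t≡0 = <-irrefl
      (pairColour-up (homogeneous-pair {f = pairColour} ac⊆ pairs) (homogeneous-pair {f = pairColour} xy⊆ pairs))
      (Up.label-increases₄
        (pair-< (refl ∷ refl ∷ minimum _))
        (pair-< (a ∷ʳ refl ∷ refl ∷ minimum _))
        (pair-< (a ∷ʳ u₁ ∷ʳ refl ∷ refl ∷ minimum _))
        (pair-< (a ∷ʳ u₁ ∷ʳ u₂ ∷ʳ refl ∷ refl ∷ minimum _))
        (pair-< (a ∷ʳ u₁ ∷ʳ u₂ ∷ʳ c ∷ʳ refl ∷ refl ∷ minimum _))
        (pair-< (a ∷ʳ u₁ ∷ʳ u₂ ∷ʳ c ∷ʳ x ∷ʳ refl ∷ refl ∷ minimum _))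
        (λ { (inj₁ refl) →
                 proj₁ (up-triple t≡0 (refl ∷ refl ∷ u₂ ∷ʳ refl ∷ minimum _))
               , proj₂ (up-triple t≡0 (a ∷ʳ refl ∷ u₂ ∷ʳ refl ∷ x ∷ʳ refl ∷ minimum _))
               , proj₁ (up-triple t≡0 (a ∷ʳ refl ∷ u₂ ∷ʳ c ∷ʳ refl ∷ refl ∷ minimum _))
           ; (inj₂ refl) →
                 proj₁ (up-triple t≡0 (refl ∷ u₁ ∷ʳ refl ∷ refl ∷ minimum _))
               , proj₂ (up-triple t≡0 (a ∷ʳ u₁ ∷ʳ refl ∷ refl ∷ x ∷ʳ refl ∷ minimum _))
               , proj₁ (up-triple t≡0 (a ∷ʳ u₁ ∷ʳ refl ∷ c ∷ʳ refl ∷ refl ∷ minimum _)) })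
        (proj₂ (up-triple t≡0 (a ∷ʳ u₁ ∷ʳ u₂ ∷ʳ c ∷ʳ refl ∷ refl ∷ refl ∷ minimum _))))
      where
      ac⊆ : a ∷ c ∷ [] ⊆ all
      ac⊆ = refl ∷ u₁ ∷ʳ u₂ ∷ʳ refl ∷ minimum _
      xy⊆ : x ∷ y ∷ [] ⊆ all
      xy⊆ = a ∷ʳ u₁ ∷ʳ u₂ ∷ʳ c ∷ʳ refl ∷ w ∷ʳ refl ∷ minimum _

    -- The same prolongation with the seven vertices read backwards: `y`, `w`, `x`, `c`, `u₂`, `u₁`,
    -- `a` take the roles of `a`, ..., `y`.
    down-impossible : ¬ t ≡ suc zero
    down-impossible t≡1 = <-irrefl
      (pairColour-down (homogeneous-pair {f = pairColour} cy⊆ pairs) (homogeneous-pair {f = pairColour} au₂⊆ pairs))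
      (Down.label-increases₄
        (pair-< (a ∷ʳ u₁ ∷ʳ u₂ ∷ʳ c ∷ʳ x ∷ʳ refl ∷ refl ∷ minimum _))
        (pair-< (a ∷ʳ u₁ ∷ʳ u₂ ∷ʳ c ∷ʳ refl ∷ refl ∷ minimum _))
        (pair-< (a ∷ʳ u₁ ∷ʳ u₂ ∷ʳ refl ∷ refl ∷ minimum _))
        (pair-< (a ∷ʳ u₁ ∷ʳ refl ∷ refl ∷ minimum _))
        (pair-< (a ∷ʳ refl ∷ refl ∷ minimum _))
        (pair-< (refl ∷ refl ∷ minimum _))
        (λ { (inj₁ refl) →
                 proj₂ (down-triple t≡1 (a ∷ʳ u₁ ∷ʳ u₂ ∷ʳ refl ∷ x ∷ʳ refl ∷ refl ∷ minimum _))
               , proj₁ (down-triple t≡1 (a ∷ʳ refl ∷ u₂ ∷ʳ refl ∷ x ∷ʳ refl ∷ minimum _))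
               , proj₂ (down-triple t≡1 (a ∷ʳ refl ∷ refl ∷ c ∷ʳ x ∷ʳ refl ∷ minimum _))
           ; (inj₂ refl) →
                 proj₂ (down-triple t≡1 (a ∷ʳ u₁ ∷ʳ u₂ ∷ʳ refl ∷ refl ∷ w ∷ʳ refl ∷ minimum _))
               , proj₁ (down-triple t≡1 (a ∷ʳ refl ∷ u₂ ∷ʳ refl ∷ refl ∷ minimum _))
               , proj₂ (down-triple t≡1 (a ∷ʳ refl ∷ refl ∷ c ∷ʳ refl ∷ minimum _)) })
        (proj₁ (down-triple t≡1 (refl ∷ refl ∷ refl ∷ minimum _))))
      where
      cy⊆ : c ∷ y ∷ [] ⊆ all
      cy⊆ = a ∷ʳ u₁ ∷ʳ u₂ ∷ʳ refl ∷ x ∷ʳ w ∷ʳ refl ∷ minimum _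
      au₂⊆ : a ∷ u₂ ∷ [] ⊆ all
      au₂⊆ = refl ∷ u₁ ∷ʳ refl ∷ minimum _

  no-homogeneous-seven : ∀ {vs p t} → 7 ≤ length vs → AllPairs Fin._<_ vs →
    Homogeneous 2 pairColour p vs → ¬ Homogeneous 3 tripleColour t vs
  no-homogeneous-seven {_ ∷ _ ∷ _ ∷ _ ∷ _ ∷ _ ∷ _ ∷ _} {t = zero} 7≤ increasing pairs triples =
    up-impossible increasing pairs triples refl
  no-homogeneous-seven {_ ∷ _ ∷ _ ∷ _ ∷ _ ∷ _ ∷ _ ∷ _} {t = suc zero} 7≤ increasing pairs triples =
    down-impossible increasing pairs triples refl
  no-homogeneous-seven {_ ∷ _ ∷ _ ∷ _ ∷ _ ∷ _ ∷ []} (s≤s (s≤s (s≤s (s≤s (s≤s (s≤s ()))))))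
  no-homogeneous-seven {_ ∷ _ ∷ _ ∷ _ ∷ _ ∷ []} (s≤s (s≤s (s≤s (s≤s (s≤s ())))))
  no-homogeneous-seven {_ ∷ _ ∷ _ ∷ _ ∷ []} (s≤s (s≤s (s≤s (s≤s ()))))
  no-homogeneous-seven {_ ∷ _ ∷ _ ∷ []} (s≤s (s≤s (s≤s ())))
  no-homogeneous-seven {_ ∷ _ ∷ []} (s≤s (s≤s ()))
  no-homogeneous-seven {_ ∷ []} (s≤s ())

-- There are `(s + 1)²` pairs of labels, and `ramsey` takes the number of colours less one. Triples
-- are coloured only inside the set found for pairs.
forces-tightPath : ∀ {n} s T → TripleRamsey 7 T →
  ramsey (s + s * suc s) 2 T ≤ n → ForcesTightPath n 3 s
forces-tightPath {n} s T ramsey-seven enough G tour = decidable-stable (contains? G (tightPath s)) λ free →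
  let open NoLongPath G tour free
      xs , xs⊆ , T≤xs , p , pairs = ramsey-theorem (s + s * suc s) 2 T (allFin n) pairColour
        (subst (ramsey (s + s * suc s) 2 T ≤_) (sym (List.length-tabulate {n = n} (λ i → i))) enough)
      ys , ys⊆ , 7≤ys , t , triples = ramsey-seven xs tripleColour T≤xs
  in no-homogeneous-seven 7≤ys (allPairs-⊆ (⊆-trans ys⊆ xs⊆) (AllPairs.tabulate⁺-< (λ i<j → i<j)))
       (homogeneous-⊆ 2 {pairColour} ys⊆ pairs) triples

-- Choice of parameters

n<2^n : ∀ n → n < 2 ^ n
n<2^n zero    = z<s
n<2^n (suc n) = +-mono-≤ (m^n>0 2 n) (≤-trans (n<2^n n) (≤-reflexive (sym (+-identityʳ (2 ^ n)))))

last-true : ∀ {P : ℕ → Set} → Decidable P → P 0 → ∀ m → (∀ i → P i → i ≤ m) → ∃[ i ] P i × ¬ P (suc i)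
last-true P? p₀ m bound = greatest P? m , greatest-holds P? m p₀ , λ p →
  1+n≰n (greatest-upper P? m (suc (greatest P? m)) (bound _ p) p)

log₂-bounds : ∀ n → 1 ≤ n → ∃[ L ] 2 ^ L ≤ n × n < 2 ^ suc L
log₂-bounds n 1≤n =
  let L , below , above = last-true (λ i → 2 ^ i ≤? n) 1≤n n (λ i 2^i≤n → <⇒≤ (<-≤-trans (n<2^n i) 2^i≤n))
  in L , below , ≰⇒> above

log₂-≥ : ∀ {n L} k → 2 ^ k ≤ n → n < 2 ^ suc L → k ≤ L
log₂-≥ {n} {L} k 2^k≤n n< = ≮⇒≥ λ L<k →
  <-irrefl refl (<-≤-trans n< (≤-trans (^-monoʳ-≤ 2 L<k) 2^k≤n))

-- `l` is the integer part of the binary logarithm of `L`, less 2: the shift pays for the factor 1/4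
-- in the lower bound for ln n, and `L ≥ 8` keeps `l` positive.
log₂-log₂-bounds : ∀ L → 8 ≤ L → ∃[ l ] 1 ≤ l × 2 ^ (2 + l) ≤ L × L < 2 ^ (3 + l)
log₂-log₂-bounds L 8≤L =
  let m , lower , upper = log₂-bounds L (≤-trans (s≤s z≤n) 8≤L)
  in shifted m (log₂-≥ 3 8≤L upper) lower upper
  where
  shifted : ∀ m → 3 ≤ m → 2 ^ m ≤ L → L < 2 ^ suc m → ∃[ l ] 1 ≤ l × 2 ^ (2 + l) ≤ L × L < 2 ^ (3 + l)
  shifted (suc (suc l)) (s≤s (s≤s 1≤l)) lower upper = l , 1≤l , lower , upper

1≤4Tl : ∀ {T l} → 1 ≤ T → 1 ≤ l → 1 ≤ 4 * T * l
1≤4Tl {T} {l} 1≤T 1≤l = *-mono-≤ {1} {4 * T} {1} {l} (*-mono-≤ {1} {4} {1} {T} (s≤s z≤n) 1≤T) 1≤l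

square-≤ : ∀ {T l L} v → 1 ≤ T → 1 ≤ l → 4 * T * l * (v * v) ≤ L → v * v ≤ L
square-≤ v 1≤T 1≤l below = ≤-trans (≤-reflexive (sym (*-identityˡ (v * v))))
  (≤-trans (*-monoˡ-≤ (v * v) (1≤4Tl 1≤T 1≤l)) below)

m≤m*m : ∀ m → m ≤ m * m
m≤m*m zero    = z≤n
m≤m*m (suc m) = m≤m*n (suc m) (suc m)

-- With k = (s+1)² the Ramsey bound is (k+1)^(kT). Here k+1 ≤ L+1 ≤ 2^(3+l), so the exponent of 2 is
-- at most (3+l)kT ≤ 4lkT ≤ L.
ramsey-pairs-2^ : ∀ {L l s T} → 1 ≤ l → 1 ≤ T → L < 2 ^ (3 + l) → 4 * T * l * (suc s * suc s) ≤ L →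
  ramsey (s + s * suc s) 2 T ≤ 2 ^ L
ramsey-pairs-2^ {L} {l} {s} {T} 1≤l 1≤T L< below = begin
  ramsey (s + s * suc s) 2 T      ≤⟨ ramsey-pairs (s + s * suc s) T ⟩
  suc k ^ (k * T)                 ≤⟨ ^-monoˡ-≤ (k * T) (≤-trans (s≤s k≤L) L<) ⟩
  (2 ^ (3 + l)) ^ (k * T)         ≡⟨ ^-*-assoc 2 (3 + l) (k * T) ⟩
  2 ^ ((3 + l) * (k * T))         ≤⟨ ^-monoʳ-≤ 2 exponent≤L ⟩
  2 ^ L                           ∎
  where
  open ≤-Reasoning
  k : ℕ
  k = suc s * suc s
  k≤L : k ≤ L
  k≤L = square-≤ (suc s) 1≤T 1≤l below
  3+l≤4l : 3 + l ≤ 4 * l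
  3+l≤4l = ≤-trans (+-monoˡ-≤ l (*-monoʳ-≤ 3 1≤l)) (≤-reflexive (+-comm (3 * l) l))
  exponent≤L : (3 + l) * (k * T) ≤ L
  exponent≤L = ≤-trans (*-monoˡ-≤ (k * T) 3+l≤4l) (≤-trans (≤-reflexive (rearrange l k T)) below)
    where
    rearrange : ∀ l k T → 4 * l * (k * T) ≡ 4 * T * l * k
    rearrange = solve-∀

f₃≥ : ∀ {n s} → s ≤ n → ForcesTightPath n 3 s → s ≤ f₃ n 3
f₃≥ {n} {s} s≤n forces = greatest-upper (forcesTightPath? n 3) n s s≤n forces

forces-one : ∀ {n} → 1 ≤ n → ForcesTightPath n 3 1
forces-one 1≤n G _ = (λ _ → fromℕ< 1≤n)
  , (λ { {zero} {zero} _ → refl })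
  , (λ { zero zero _ () })

-- Here 2^L ≈ n and 2^(l+2) ≈ L, and u is the largest integer with 4Tl u² ≤ L, which makes
-- the Ramsey bound for paths on u - 1 vertices at most 2^L.
module Parameters {T n L l u} (ramsey-seven : TripleRamsey 7 T) (1≤T : 1 ≤ T) (1≤l : 1 ≤ l)
  (2^L≤n : 2 ^ L ≤ n) (L< : L < 2 ^ (3 + l))
  (below : 4 * T * l * (u * u) ≤ L) (above : L < 4 * T * l * (suc u * suc u)) where

  1≤n : 1 ≤ n
  1≤n = ≤-trans (m^n>0 2 L) 2^L≤n

  1≤f₃ : 1 ≤ f₃ n 3
  1≤f₃ = f₃≥ 1≤n (forces-one 1≤n)

  -- For `v = s + 1` the path has `s` vertices, one fewer than `v`, because labels take `s + 1`
  -- values.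
  ≤1+f₃ : ∀ v → 4 * T * l * (v * v) ≤ L → v ≤ suc (f₃ n 3)
  ≤1+f₃ zero    _     = z≤n
  ≤1+f₃ (suc s) below = s≤s (f₃≥ s≤n (forces-tightPath s T ramsey-seven
    (≤-trans (ramsey-pairs-2^ {s = s} 1≤l 1≤T L< below) 2^L≤n)))
    where
    s≤n : s ≤ n
    s≤n = begin
      s              ≤⟨ n≤1+n s ⟩
      suc s          ≤⟨ m≤m*m (suc s) ⟩
      suc s * suc s  ≤⟨ square-≤ (suc s) 1≤T 1≤l below ⟩
      L              ≤⟨ <⇒≤ (n<2^n L) ⟩
      2 ^ L          ≤⟨ 2^L≤n ⟩
      n              ∎
      where open ≤-Reasoning

  -- A multiple of `u + 1` whose square times `l` dominates `16L`: by `above`, 16L is at most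
  -- 64Tl(u+1)², and B²l = 256T²l(u+1)².
  B : ℕ
  B = 16 * T * suc u

  B≤ : B ≤ 48 * T * f₃ n 3
  B≤ = begin
    -- Since `f₃ n 3` is at least 1, u + 1 ≤ f₃ + 2 ≤ 3 f₃.
    16 * T * suc u             ≤⟨ *-monoʳ-≤ (16 * T) (≤-trans (s≤s (≤1+f₃ u below))
                                    (+-monoˡ-≤ (f₃ n 3) (*-monoʳ-≤ 2 1≤f₃))) ⟩
    16 * T * (2 * f₃ n 3 + f₃ n 3) ≡⟨ rearrange T (f₃ n 3) ⟩
    48 * T * f₃ n 3            ∎
    where
    open ≤-Reasoning
    rearrange : ∀ T f → 16 * T * (2 * f + f) ≡ 48 * T * f
    rearrange = solve-∀

  16L≤ : 16 * L ≤ B * B * l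
  16L≤ = begin
    16 * L                              ≤⟨ *-monoʳ-≤ 16 (<⇒≤ above) ⟩
    16 * (4 * T * l * (suc u * suc u))  ≤⟨ *-monoʳ-≤ 16 (*-monoˡ-≤ (suc u * suc u) (*-monoˡ-≤ l T≤)) ⟩
    16 * (16 * T * T * l * (suc u * suc u)) ≡⟨ rearrange T l (suc u) ⟩
    B * B * l                           ∎
    where
    open ≤-Reasoning
    rearrange : ∀ T l v → 16 * (16 * T * T * l * (v * v)) ≡ 16 * T * v * (16 * T * v) * l
    rearrange = solve-∀
    T≤ : 4 * T ≤ 16 * T * T
    T≤ = begin
      4 * T       ≡⟨ *-identityʳ (4 * T) ⟨
      4 * T * 1   ≤⟨ *-mono-≤ (*-monoˡ-≤ T (m≤m+n 4 12)) 1≤T ⟩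
      16 * T * T  ∎

-- T stays a variable because ramsey 1 3 7 is far too large to be evaluated.
theorem28-from : ∃[ T ] 1 ≤ T × TripleRamsey 7 T →
  ∃[ c ] (0ℝ <ℝ c × ∃[ n₀ ] (∀ n (3≤n : 3 ≤ n) → n₀ ≤ n →
    c *ℝ √ (divide (lnℕ n 3≤n) (lnlnℕ n 3≤n) (0<lnlnℕ n 3≤n)) ≤ℝ fromℕ (f₃ n 3)))
-- The constant is 1/(48T), from `B≤`; `n ≥ 2 ^ 8` ensures `L ≥ 8`.
theorem28-from (T , 1≤T , ramsey-seven) = fromℚ (inv (ι K)) , 0<c , 2 ^ 8 , bound
  where
  K : ℕ
  K = 48 * T
  1≤K : 1 ≤ K
  1≤K = *-mono-≤ {1} {48} {1} {T} (s≤s z≤n) 1≤T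
  0<c : 0ℝ <ℝ fromℚ (inv (ι K))
  0<c = inv (ι K) , 0<inv (ℚ.<-≤-trans 0<1 (ι-mono 1≤K)) , 0 , λ _ _ → ℚ.≤-reflexive (ℚ.+-identityˡ (inv (ι K)))
  bound : ∀ n (3≤n : 3 ≤ n) → 2 ^ 8 ≤ n →
    fromℚ (inv (ι K)) *ℝ √ (divide (lnℕ n 3≤n) (lnlnℕ n 3≤n) (0<lnlnℕ n 3≤n)) ≤ℝ fromℕ (f₃ n 3)
  bound n 3≤n 256≤n =
    let L , 2^L≤n , n<2^ = log₂-bounds n (≤-trans (s≤s z≤n) 3≤n)
        8≤L = log₂-≥ 8 256≤n n<2^
        l , 1≤l , 2^l≤L , L<2^ = log₂-log₂-bounds L 8≤L
        u , below , above = last-true (λ u → 4 * T * l * (u * u) ≤? L)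
          (≤-trans (≤-reflexive (*-zeroʳ (4 * T * l))) z≤n) L
          (λ u below → ≤-trans (m≤m*m u) (square-≤ u 1≤T 1≤l below))
        open Parameters {T} {n} {L} {l} {u} ramsey-seven 1≤T 1≤l 2^L≤n L<2^ below (≰⇒> above)
    in Logarithm.√-ratio-bound {n} {L} {l} {B} {K} 3≤n 1≤l 2^L≤n (<⇒≤ n<2^) 2^l≤L 16L≤ 1≤K B≤

theorem28 : ∃[ c ] (0ℝ <ℝ c × ∃[ n₀ ] (∀ n (3≤n : 3 ≤ n) → n₀ ≤ n →
    c *ℝ √ (divide (lnℕ n 3≤n) (lnlnℕ n 3≤n) (0<lnlnℕ n 3≤n)) ≤ℝ fromℕ (f₃ n 3)))
theorem28 = theorem28-from (triple-ramsey 7)
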